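{- For all $r\ge0$ and $0\le i\le r$, the parking triangle numbers $T(r,i)=\big|\mathcal{U}^i_{\mathrm{Car}_{r+3}}(1,1,\ldots,1)\big|$ satisfy $$T(r,i)=(r+1)^{i-1}\binom{2r-i}{r}.$$
   Context: Put $n=r+2$. The caracol graph $\mathrm{Car}_{n+1}=\mathrm{Car}_{r+3}$ is the directed graph on $\{1,\ldots,n+1\}$ with edges $(1,j)$ for $2\le j\le n$, $(i,i+1)$ for $2\le i\le n$, and $(i,n+1)$ for $2\le i\le n-1$. Its shifted out-degree vector (entries: out-degree of $i$ minus $1$, for $i=1,\ldots,n$) is $\mathbf{t}=(r,1,\ldots,1,0)$, with $|\mathbf{t}|=2r$. Its restriction $(\mathrm{Car}_{n+1})|_n$ to the vertices $1,\ldots,n$ has edges $(1,j)$, $2\le j\le n$, and $(i,i+1)$, $2\le i\le n-1$. A $\mathbf{t}$-Dyck path is a sequence of nonnegative integers $\mathbf{s}=(s_1,\ldots,s_n)$ with sum $|\mathbf{t}|$ and $\sum_{j\le k}s_j\ge\sum_{j\le k}t_j$ for all $k$, identified with the lattice path $N^{s_1}EN^{s_2}E\cdots N^{s_n}E$. Gravity diagrams: for a graph $H$ on $[n]$ (edges directed from smaller to larger vertices) and $\mathbf{v}\in\mathbb{Z}^n$ with entry sum $0$, write $\mathbf{v}=\sum_{k=1}^{n-1}d_k\boldsymbol{\alpha}_k$, $\boldsymbol{\alpha}_k=\mathbf{e}_k-\mathbf{e}_{k+1}$. A line-dot diagram is a partition of an array of dots with $d_k$ dots in column $k$ (none exists if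 some $d_k<0$) into lines, each line assigned to an edge $(p,q)$ of $H$ and consisting of exactly one dot from each of the columns $p,\ldots,q-1$. Two are equivalent if each edge is assigned the same number of lines in both. $\mathcal{GD}_H(\mathbf{v})$ is the set of equivalence classes; equivalently it is the set of ways of writing $\mathbf{v}$ as a nonnegative integer combination of the vectors $\mathbf{e}_p-\mathbf{e}_q$, $(p,q)\in E(H)$. Level-$i$ refined unified diagrams: $\mathcal{U}^i_{\mathrm{Car}_{r+3}}(1,\ldots,1)$ is the set of triples $(\mathbf{s},\sigma,D)$ where $\mathbf{s}$ is a $\mathbf{t}$-Dyck path with $s_1=|\mathbf{t}|-i$ (i.e. the first east step is $i$ levels below the top line), $\sigma$ is a permutation of $[i]$ labeling the $i$ north steps not in the first column, with labels increasing along consecutive north steps in each column, and $D\in\mathcal{GD}_{(\mathrm{Car}_{r+3})|_{r+2}}(\mathbf{s}-\mathbf{t})$. -}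

module Defs where

open import Data.Bool.Base using (if_then_else_)
open import Data.Fin.Base using (Fin; zero; suc; toℕ; inject₁; cast)
import Data.Fin.Base as Fin
open import Data.Fin.Properties using (toℕ-cast)
import Data.Fin.Properties as Fin
open import Data.Integer.Base as ℤ using (ℤ; +_; -[1+_]; 0ℤ; 1ℤ)
import Data.Integer.Properties as ℤ
open import Data.List.Base using (length; filter; allFin)
open import Data.Nat.Base as ℕ using (ℕ; zero; suc; NonZero)
import Data.Nat.Properties as ℕ
open import Data.Product using (Σ; Σ-syntax; _×_; _,_; ∃!)
open import Data.Rational.Base using (ℚ; _/_)
open import Data.Sum.Base using (_⊎_; inj₁; inj₂)
open import Data.Vec.Base using (Vec; lookup; head)
open import Function.Bundles using (Bijection; Inverse; _↔_)
open import Level using (0ℓ)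
open import Relation.Binary.Bundles using (Setoid)
open import Relation.Binary.Definitions using (Decidable)
open import Relation.Binary.PropositionalEquality
  using (_≡_; refl; sym; trans; cong; setoid)
open import Relation.Nullary.Decidable using (does; _×-dec_; _⊎-dec_)

open import Algebra.Properties.CommutativeMonoid.Sum ℤ.+-0-commutativeMonoid
  using (sum; sum-syntax)

HasCardinality : Setoid 0ℓ 0ℓ → ℕ → Set
HasCardinality S m = Bijection (setoid (Fin m)) S

infixr 8 _^ℤ_

_^ℤ_ : (b : ℕ) .{{_ : NonZero b}} → ℤ → ℚ
b ^ℤ (+ k)    = + (b ℕ.^ k) / 1
b ^ℤ -[1+ k ] = (1ℤ / (b ℕ.^ suc k)) {{ℕ.m^n≢0 b (suc k)}}

-- The first entries of f, up to and including position k.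
partialSum : ∀ {n} → (Fin n → ℤ) → Fin n → ℤ
partialSum f zero    = f zero
partialSum f (suc k) = f zero ℤ.+ partialSum (λ j → f (suc j)) k

------------------------------------------------------------------------
-- Directed graphs

-- The vertex called j in [n] is the element of Fin n with toℕ equal to j - 1.
record Digraph (n : ℕ) : Set₁ where
  field
    Edge      : Fin n → Fin n → Set
    edge?     : Decidable Edge
    ascending : ∀ {p q} → Edge p q → p Fin.< q

open Digraph

-- Restriction to all vertices but the last.
restrict : ∀ {n} → Digraph (suc n) → Digraph n
restrict G .Edge p q = Edge G (inject₁ p) (inject₁ q)
restrict G .edge? p q = edge? G (inject₁ p) (inject₁ q)
restrict G .ascending {p} {q} e with ascending G e
... | p<q rewrite Fin.toℕ-inject₁ p | Fin.toℕ-inject₁ q = p<q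

outDegree : ∀ {n} → Digraph n → Fin n → ℕ
outDegree G p = length (filter (edge? G p) (allFin _))

-- The last vertex gets no entry.
shiftedOutDegree : ∀ {n} → Digraph (suc n) → Fin n → ℤ
shiftedOutDegree G p = + outDegree G (inject₁ p) ℤ.- 1ℤ

-- The edges of Car_{n+1} in terms of the vertex names 1, …, n+1.
CarEdge : (n a b : ℕ) → Set
CarEdge n a b = (a ≡ 1 × 2 ℕ.≤ b × b ℕ.≤ n)
              ⊎ (2 ℕ.≤ a × a ℕ.≤ n × b ≡ suc a)
              ⊎ (2 ℕ.≤ a × suc a ℕ.≤ n × b ≡ suc n)

CarEdge-ascending : ∀ n a b → CarEdge n a b → a ℕ.< b
CarEdge-ascending n a b (inj₁ (refl , 2≤b , _))               = 2≤b
CarEdge-ascending n a b (inj₂ (inj₁ (_ , _ , refl)))          = ℕ.≤-refl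
CarEdge-ascending n a b (inj₂ (inj₂ (_ , a<n , refl)))        = ℕ.m≤n⇒m≤1+n a<n

caracol : (n : ℕ) → Digraph (suc n)
caracol n .Edge p q = CarEdge n (suc (toℕ p)) (suc (toℕ q))
caracol n .edge? p q =
        (a ℕ.≟ 1 ×-dec 2 ℕ.≤? b ×-dec b ℕ.≤? n)
  ⊎-dec (2 ℕ.≤? a ×-dec a ℕ.≤? n ×-dec b ℕ.≟ suc a)
  ⊎-dec (2 ℕ.≤? a ×-dec suc a ℕ.≤? n ×-dec b ℕ.≟ suc n)
  where
  a = suc (toℕ p)
  b = suc (toℕ q)
caracol n .ascending e = ℕ.s≤s⁻¹ (CarEdge-ascending n _ _ e)

------------------------------------------------------------------------
-- t-Dyck paths

record IsDyckPath {n} (t : Fin n → ℤ) (s : Vec ℕ n) : Set where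
  field
    total    : ∑[ j < n ] (+ lookup s j) ≡ sum t
    dominant : ∀ k → partialSum t k ℤ.≤ partialSum (λ j → + lookup s j) k

-- The north steps that are not in the first column; (c , k) is the k-th one
-- from the bottom in its column.
NorthStep : ∀ {n} → Vec ℕ (suc n) → Set
NorthStep {n} s = Σ[ c ∈ Fin n ] Fin (lookup s (suc c))

------------------------------------------------------------------------
-- Gravity diagrams

e : ∀ {n} → Fin n → Fin n → ℤ
e p j = if does (p Fin.≟ j) then 1ℤ else 0ℤ

α : ∀ {n} → Fin n → Fin (suc n) → ℤ
α k j = e (inject₁ k) j ℤ.- e (suc k) j

-- Since the α k are linearly independent, d is determined by v; since d is
-- natural-number valued, there is no diagram when a coefficient is negative.
-- The partition of the dots is given by the map lineOf from dots to lines.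
record LineDotDiagram {n} (H : Digraph (suc n)) (v : Fin (suc n) → ℤ) : Set where
  field
    d        : Fin n → ℕ
    expand   : ∀ j → v j ≡ ∑[ k < n ] (+ d k ℤ.* α k j)
    #lines   : ℕ
    source   : Fin #lines → Fin (suc n)
    target   : Fin #lines → Fin (suc n)
    isEdge   : ∀ ℓ → Edge H (source ℓ) (target ℓ)
    lineOf   : ∀ k → Fin (d k) → Fin #lines

  -- The column k belongs to the columns p, …, q-1 of the edge (p , q) of ℓ.
  Spans : Fin #lines → Fin n → Set
  Spans ℓ k = source ℓ Fin.≤ k × k Fin.< target ℓ

  field
    oneInside   : ∀ ℓ k → Spans ℓ k → ∃! _≡_ (λ (x : Fin (d k)) → lineOf k x ≡ ℓ)
    noneOutside : ∀ k x → Spans (lineOf k x) k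

  multiplicity : Fin (suc n) → Fin (suc n) → ℕ
  multiplicity p q =
    length (filter (λ ℓ → (source ℓ Fin.≟ p) ×-dec (target ℓ Fin.≟ q)) (allFin #lines))

open LineDotDiagram using (multiplicity)

-- Equivalence of line-dot diagrams, stated for possibly different v and w so
-- that it also compares the diagrams attached to different Dyck paths.
_≈ᴳ_ : ∀ {n} {H : Digraph (suc n)} {v w} → LineDotDiagram H v → LineDotDiagram H w → Set
D ≈ᴳ D′ = ∀ p q → multiplicity D p q ≡ multiplicity D′ p q

------------------------------------------------------------------------
-- Level-i refined unified diagrams of Car_{r+3}

Car : (r : ℕ) → Digraph (3 ℕ.+ r)
Car r = caracol (2 ℕ.+ r)

carShift : (r : ℕ) → Fin (2 ℕ.+ r) → ℤ
carShift r = shiftedOutDegree (Car r)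

record UnifiedDiagram (r i : ℕ) : Set where
  field
    s          : Vec ℕ (2 ℕ.+ r)
    isDyckPath : IsDyckPath (carShift r) s
    level      : + head s ≡ sum (carShift r) ℤ.- + i
    σ          : NorthStep s ↔ Fin i
    increasing : ∀ c {k k′} → k Fin.< k′ → Inverse.to σ (c , k) Fin.< Inverse.to σ (c , k′)
    diagram    : LineDotDiagram (restrict (Car r)) (λ j → + lookup s j ℤ.- carShift r j)

open UnifiedDiagram

-- Equality of triples (s , σ , D), with D taken up to equivalence. The labels
-- are compared at equal positions because σ has a type depending on s.
record _≈ᵁ_ {r i} (U U′ : UnifiedDiagram r i) : Set where
  field
    path   : s U ≡ s U′
    labels : ∀ c k k′ → toℕ k ≡ toℕ k′ → Inverse.to (σ U) (c , k) ≡ Inverse.to (σ U′) (c , k′)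
    lines  : diagram U ≈ᴳ diagram U′

open _≈ᵁ_

-- 𝒰 r i is the set of level-i refined unified diagrams of Car_{r+3} for the
-- netflow (1, …, 1).
𝒰 : (r i : ℕ) → Setoid 0ℓ 0ℓ
𝒰 r i = record
  { Carrier       = UnifiedDiagram r i
  ; _≈_           = _≈ᵁ_
  ; isEquivalence = record
    { refl  = λ {U} → record
      { path   = refl
      ; labels = λ c k k′ k≡k′ → cong (λ x → Inverse.to (σ U) (c , x)) (Fin.toℕ-injective k≡k′)
      ; lines  = λ p q → refl
      }
    ; sym   = λ U≈U′ → record
      { path   = sym (path U≈U′)
      ; labels = λ c k k′ k≡k′ → sym (labels U≈U′ c k′ k (sym k≡k′))
      ; lines  = λ p q → sym (lines U≈U′ p q)
      }
    ; trans = λ U≈U′ U′≈U″ → record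
      { path   = trans (path U≈U′) (path U′≈U″)
      ; labels = λ c k k″ k≡k″ →
          let eq = cong (λ v → lookup v (suc c)) (path U≈U′)
          in trans (labels U≈U′ c k (cast eq k) (sym (toℕ-cast eq k)))
                   (labels U′≈U″ c (cast eq k) k″ (trans (toℕ-cast eq k) k≡k″))
      ; lines  = λ p q → trans (lines U≈U′ p q) (lines U′≈U″ p q)
      }
    }
  }

{-# OPTIONS --safe #-}

-- Read a unified diagram as a distribution of r cars over the r + 1 spots c = 0, …, r:
-- the north step labelled x is a labelled car on the spot c of its column, and every
-- line on an edge (1 , c + 2) is an unlabelled car on the spot c. The path and its
-- labelling are recovered from the labelled cars, and the netflow condition forces the
-- multiplicity of the edge (k + 1 , k + 2) to be the number of cars on the spots below k
-- minus k. That these numbers are nonnegative is a parking condition, which implies the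
-- Dyck condition. By Pollak's circle argument exactly one of the r + 1 rotations of a
-- distribution satisfies it, and there are (r + 1)^i C(2r - i, r) distributions of i
-- labelled and r - i unlabelled cars.
module Submission where

open import Defs
open import Data.Bool.Base using (if_then_else_)
open import Data.Fin.Base as Fin using (Fin; zero; suc; toℕ; fromℕ; inject₁; _↑ˡ_; _↑ʳ_)
import Data.Fin.Properties as Fin
open import Data.Fin.Relation.Unary.Top using (view; ‵fromℕ; ‵inject₁)
open import Data.Integer.Base as ℤ using (ℤ; +_; 0ℤ; 1ℤ; _-_)
import Data.Integer.Properties as ℤ
open import Data.List.Base as List using (List; []; _∷_; length; filter; allFin)
import Data.List.Properties as List
open import Data.List.Membership.Propositional.Properties
  using (∈-filter⁺; ∈-filter⁻; ∈-allFin; ∈-lookup)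
import Data.List.Relation.Unary.All as All
open import Data.List.Relation.Unary.AllPairs using (AllPairs; _∷_)
import Data.List.Relation.Unary.AllPairs.Properties as AllPairs
open import Data.List.Relation.Unary.Any using (index)
open import Data.List.Relation.Unary.Any.Properties using (lookup-index)
open import Data.Nat.Base as ℕ
  using (ℕ; zero; suc; _+_; _∸_; _^_; _≤_; _<_; s≤s; z≤n) renaming (_*_ to _*ℕ_)
open import Data.Nat.Combinatorics using (_C_; nCn≡1; nCk+nC[k+1]≡[n+1]C[k+1])
import Data.Nat.Properties as ℕ
open import Data.Product.Base using (Σ-syntax; ∃-syntax; _×_; _,_; proj₁; proj₂; uncurry)
open import Data.Product.Function.NonDependent.Propositional using (_×-↔_)
open import Data.Rational.Base using (_/_; _*_)
import Data.Rational.Base as ℚ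
import Data.Rational.Properties as ℚ
open import Data.Rational.Unnormalised.Base as ℚᵘ using (mkℚᵘ; *≡*)
import Data.Rational.Unnormalised.Properties as ℚᵘ
open import Data.Sum.Base using (_⊎_; inj₁; inj₂; [_,_]′)
open import Data.Sum.Function.Propositional using (_⊎-↔_)
open import Data.Vec.Base as Vec
  using (Vec; []; _∷_; _∷ʳ_; head; lookup; map; replicate; sum; tabulate; toList; zipWith)
import Data.Vec.Properties as Vec
open import Function.Base using (_∘_; id)
open import Function.Bundles using (Injection; Inverse; _↔_; mk⤖; mk↔ₛ′)
open import Function.Consequences.Propositional using (strictlySurjective⇒surjective)
open import Function.Definitions using (Injective)
open import Function.Properties.Bijection using (⤖⇒↔)
open import Function.Properties.Inverse using (↔⇒↣; ↔-refl; ↔-sym; ↔-trans)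
open import Level using (Level)
open import Relation.Binary.Definitions using (tri<; tri≈; tri>)
open import Relation.Binary.PropositionalEquality hiding (J)
open import Relation.Nullary.Decidable
  using (Dec; yes; no; does; dec-true; dec-false; map′; _×-dec_)
open import Relation.Nullary.Negation using (¬_; contradiction)
open import Relation.Unary using (Pred; Decidable)

open import Algebra.Properties.AbelianGroup ℤ.+-0-abelianGroup
  using () renaming (∙-cancelˡ to ℤ-cancelˡ)
import Algebra.Properties.CommutativeMonoid.Sum ℤ.+-0-commutativeMonoid as ∑
open ∑ using (sum-syntax)
open import Algebra.Properties.CommutativeSemigroup ℕ.+-commutativeSemigroup
  using (interchange; x∙yz≈y∙xz; xy∙z≈xz∙y)
open import Algebra.Properties.CommutativeSemigroup ℤ.+-commutativeSemigroup
  using () renaming (interchange to ℤ-interchange)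

open Digraph using (Edge; edge?)
open LineDotDiagram using (multiplicity)
open UnifiedDiagram using (s; level; σ; increasing; diagram)

-- Why the numbers fit: `s` starts with `2r - i` north steps and the shift vector with `r`, so the
-- first column of the gravity diagram has `a = r - i` dots. Only edges leaving the first vertex
-- meet that column; hence the number of unlabelled cars is forced to be `a`, and there are `r` cars
-- in all. In column `k`, counted from 0, the netflow leaves `a + F - k` dots, where `F` is the
-- number of labelled cars on the spots below `k`. Of the `a` jumps, those to the `Y` unlabelled
-- cars below `k` have already ended and `a - Y` pass over the column. The remaining `F + Y - k`
-- dots must belong to the one other edge that meets the column. The obstacle is equality: the type
-- of `σ` varies with the path and `D` counts only up to equivalence. So diagrams and configurations
-- are linked by a relation, `Represents`, instead of by two mutually inverse maps. The circle
-- argument gives `T` only through `T (r + 1) = (r + 1)^i C(2r - i, r)`; the division is left to the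
-- end because for `i = 0` the exponent `i - 1` is negative.

private variable
  p q ℓ : Level
  i k m n : ℕ

-- Counting and enumerating decidable subsets of `Fin n`

count : {P : Pred (Fin n) p} → Decidable P → ℕ
count P? = length (filter P? (allFin _))

lookup-AllPairs : {A : Set p} {R : A → A → Set q} {xs : List A} → AllPairs R xs →
                  ∀ {i j} → i Fin.< j → R (List.lookup xs i) (List.lookup xs j)
lookup-AllPairs (Rx ∷ _)  {zero}  {suc j} _         = All.lookup Rx (∈-lookup j)
lookup-AllPairs (_ ∷ Rxs) {suc i} {suc j} (s≤s i<j) = lookup-AllPairs Rxs i<j

mono⇒injective : {g : Fin k → Fin m} → (∀ {x y} → x Fin.< y → g x Fin.< g y) →
                 Injective _≡_ _≡_ g
mono⇒injective mono {x} {y} gx≡gy with Fin.<-cmp x y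
... | tri< x<y _ _ = contradiction gx≡gy (Fin.<⇒≢ (mono x<y))
... | tri≈ _ x≡y _ = x≡y
... | tri> _ _ y<x = contradiction (sym gx≡gy) (Fin.<⇒≢ (mono y<x))

module _ {P : Pred (Fin n) p} (P? : Decidable P) where

  -- The filtered list keeps the order of `allFin n`, so this is the increasing enumeration of `P`.
  -- It later provides the labels of a column, the dots of a column of lines and the list of parking
  -- configurations.
  nth : Fin (count P?) → Fin n
  nth = List.lookup (filter P? (allFin n))

  nth-sound : ∀ x → P (nth x)
  nth-sound x = proj₂ (∈-filter⁻ P? {xs = allFin n} (∈-lookup x))

  nth-complete : ∀ {y} → P y → ∃[ x ] nth x ≡ y
  nth-complete {y} Py = index y∈ , sym (lookup-index y∈)
    where y∈ = ∈-filter⁺ P? (∈-allFin y) Py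

  nth-mono : ∀ {x y} → x Fin.< y → nth x Fin.< nth y
  nth-mono = lookup-AllPairs {R = Fin._<_}
    (AllPairs.filter⁺ P? (AllPairs.tabulate⁺-< {R = Fin._<_} {f = id} id))

  nth-injective : Injective _≡_ _≡_ nth
  nth-injective = mono⇒injective nth-mono

  -- The main tool for evaluating counts: any injective parametrisation of `P` has the right size,
  -- because it and `nth` inject into each other.
  count-image : {g : Fin k → Fin n} → Injective _≡_ _≡_ g → (∀ x → P (g x)) →
                (∀ {y} → P y → ∃[ x ] g x ≡ y) → k ≡ count P?
  count-image {g = g} inj sound complete = Fin.cantor-schröder-bernstein
    {f = λ x → proj₁ (nth-complete (sound x))}
    {g = λ x → proj₁ (complete (nth-sound x))}
    (λ {x} {y} eq → inj (trans (sym (proj₂ (nth-complete (sound x))))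
                        (trans (cong nth eq) (proj₂ (nth-complete (sound y))))))
    (λ {x} {y} eq → nth-injective (trans (sym (proj₂ (complete (nth-sound x))))
                                  (trans (cong g eq) (proj₂ (complete (nth-sound y))))))

count-cong : {P : Pred (Fin n) p} {Q : Pred (Fin n) q} (P? : Decidable P) (Q? : Decidable Q) →
             (∀ {x} → P x → Q x) → (∀ {x} → Q x → P x) → count P? ≡ count Q?
count-cong P? Q? P⇒Q Q⇒P =
  count-image Q? (nth-injective P?) (P⇒Q ∘ nth-sound P?) (nth-complete P? ∘ Q⇒P)

count-none : {P : Pred (Fin n) p} (P? : Decidable P) → (∀ x → ¬ P x) → count P? ≡ 0
count-none P? ¬P =
  sym (count-image P? {g = λ ()} (λ {}) (λ ()) (λ Px → contradiction Px (¬P _)))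

module _ {P : Pred (Fin n) p} {Q : Pred (Fin n) q} {R : Pred (Fin n) ℓ}
         (P? : Decidable P) (Q? : Decidable Q) (R? : Decidable R)
         (split : ∀ {x} → P x → Q x ⊎ R x) (Q⇒P : ∀ {x} → Q x → P x)
         (R⇒P : ∀ {x} → R x → P x) (disjoint : ∀ {x} → Q x → ¬ R x) where

  count-⊎ : count P? ≡ count Q? + count R?
  count-⊎ = go (allFin n)
    where
    go : ∀ xs → length (filter P? xs) ≡ length (filter Q? xs) + length (filter R? xs)
    go []       = refl
    go (x ∷ xs) with P? x | Q? x | R? x
    ... | _      | yes Qx | yes Rx = contradiction Rx (disjoint Qx)
    ... | yes _  | yes _  | no _   = cong suc (go xs)
    ... | yes _  | no _   | yes _  = trans (cong suc (go xs)) (sym (ℕ.+-suc _ _))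
    ... | no ¬Px | yes Qx | no _   = contradiction (Q⇒P Qx) ¬Px
    ... | no ¬Px | no _   | yes Rx = contradiction (R⇒P Rx) ¬Px
    ... | no _   | no _   | no _   = go xs
    ... | yes Px | no ¬Qx | no ¬Rx with split Px
    ...   | inj₁ Qx = contradiction Qx ¬Qx
    ...   | inj₂ Rx = contradiction Rx ¬Rx

count-suc : {P : Pred (Fin (suc n)) p} (P? : Decidable P) →
            count P? ≡ length (filter P? (zero ∷ [])) + count (P? ∘ suc)
count-suc {n = n} P? = trans
  (cong (λ xs → length (filter P? (zero ∷ xs))) (sym (List.map-tabulate id suc)))
  (go (allFin n))
  where
  tail : ∀ xs → length (filter P? (List.map suc xs)) ≡ length (filter (P? ∘ suc) xs)
  tail []       = refl
  tail (x ∷ xs) with P? (suc x)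
  ... | yes _ = cong suc (tail xs)
  ... | no _  = tail xs
  go : ∀ xs → length (filter P? (zero ∷ List.map suc xs)) ≡
       length (filter P? (zero ∷ [])) + length (filter (P? ∘ suc) xs)
  go xs with P? zero
  ... | yes _ = cong suc (tail xs)
  ... | no _  = tail xs

-- At a first disagreement the smaller of the two values is attained by the other enumeration at an
-- earlier position, where both agree by induction; so one enumeration would take the same value
-- twice. No equality of `k` and `k′` is assumed. This makes the set of labels in a column determine
-- the labelling of the column.
mono-unique : ∀ {k′} {g : Fin k → Fin m} {g′ : Fin k′ → Fin m} →
              (∀ {x y} → x Fin.< y → g x Fin.< g y) →
              (∀ {x y} → x Fin.< y → g′ x Fin.< g′ y) →
              (∀ x → ∃[ x′ ] g′ x′ ≡ g x) → (∀ x′ → ∃[ x ] g x ≡ g′ x′) →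
              ∀ x x′ → toℕ x ≡ toℕ x′ → g x ≡ g′ x′
mono-unique {g = g} {g′} mono mono′ g⊆g′ g′⊆g x x′ = go (suc (toℕ x)) x x′ ℕ.≤-refl
  where
  reflect : ∀ {k m} {h : Fin k → Fin m} → (∀ {x y} → x Fin.< y → h x Fin.< h y) →
            ∀ {x y} → h x Fin.< h y → x Fin.< y
  reflect mono {x} {y} hx<hy with Fin.<-cmp x y
  ... | tri< x<y _ _ = x<y
  ... | tri≈ _ refl _ = contradiction hx<hy (Fin.<-irrefl refl)
  ... | tri> _ _ y<x = contradiction (mono y<x) (Fin.<-asym hx<hy)
  go : ∀ b x x′ → toℕ x ℕ.< b → toℕ x ≡ toℕ x′ → g x ≡ g′ x′
  go (suc b) x x′ (s≤s x≤b) x≡x′ with Fin.<-cmp (g x) (g′ x′)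
  ... | tri≈ _ gx≡g′x′ _ = gx≡g′x′
  ... | tri< gx<g′x′ _ _ =
    contradiction (trans gw≡g′z g′z≡gx) (Fin.<⇒≢ (mono w<x))
    where
    z = proj₁ (g⊆g′ x)
    g′z≡gx = proj₂ (g⊆g′ x)
    z<x = subst (toℕ z ℕ.<_) (sym x≡x′) (reflect mono′ (subst (Fin._< g′ x′) (sym g′z≡gx) gx<g′x′))
    w = Fin.fromℕ< (ℕ.<-trans z<x (Fin.toℕ<n x))
    w≡z = Fin.toℕ-fromℕ< (ℕ.<-trans z<x (Fin.toℕ<n x))
    w<x = subst (ℕ._< toℕ x) (sym w≡z) z<x
    gw≡g′z = go b w z (ℕ.<-≤-trans w<x x≤b) w≡z
  ... | tri> _ _ g′x′<gx =
    contradiction (trans (sym gz≡g′w) gz≡g′x′) (Fin.<⇒≢ (mono′ w<x′))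
    where
    z = proj₁ (g′⊆g x′)
    gz≡g′x′ = proj₂ (g′⊆g x′)
    z<x = reflect mono (subst (Fin._< g x) (sym gz≡g′x′) g′x′<gx)
    z<x′ = subst (toℕ z ℕ.<_) x≡x′ z<x
    w = Fin.fromℕ< (ℕ.<-trans z<x′ (Fin.toℕ<n x′))
    w≡z = Fin.toℕ-fromℕ< (ℕ.<-trans z<x′ (Fin.toℕ<n x′))
    w<x′ = subst (ℕ._< toℕ x′) (sym w≡z) z<x′
    gz≡g′w = go b z w (ℕ.<-≤-trans z<x x≤b) (sym w≡z)

-- The cycle lemma

to-injective : {A B : Set} (A↔B : A ↔ B) → Injective _≡_ _≡_ (Inverse.to A↔B)
to-injective A↔B = Injection.injective (↔⇒↣ A↔B)

-- Ties are resolved in favour of the earlier index; the strict inequality before `j` is what the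
-- wrap-around case of `parking-exists` needs.
first-minimum : (f : ℕ → ℕ) (n : ℕ) →
                ∃[ j ] j ≤ n × (∀ {m} → m ≤ n → f j ≤ f m) × (∀ {m} → m < j → f j < f m)
first-minimum f zero = 0 , z≤n , (λ { z≤n → ℕ.≤-refl }) , λ ()
first-minimum f (suc n) with first-minimum f n
... | j , j≤n , least , first with f (suc n) ℕ.<? f j
...   | yes fn<fj = suc n , ℕ.≤-refl , least′ , λ { (s≤s m≤n) → ℕ.<-≤-trans fn<fj (least m≤n) }
  where
  least′ : ∀ {m} → m ≤ suc n → f (suc n) ≤ f m
  least′ m≤1+n with ℕ.m≤n⇒m<n∨m≡n m≤1+n
  ... | inj₁ (s≤s m≤n) = ℕ.<⇒≤ (ℕ.<-≤-trans fn<fj (least m≤n))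
  ... | inj₂ refl      = ℕ.≤-refl
...   | no fn≮fj = j , ℕ.m≤n⇒m≤1+n j≤n , least′ , first
  where
  least′ : ∀ {m} → m ≤ suc n → f j ≤ f m
  least′ m≤1+n with ℕ.m≤n⇒m<n∨m≡n m≤1+n
  ... | inj₁ (s≤s m≤n) = least m≤n
  ... | inj₂ refl      = ℕ.≮⇒≥ fn≮fj

iter : {A : Set} → (A → A) → ℕ → A → A
iter ρ zero    x = x
iter ρ (suc j) x = iter ρ j (ρ x)

iter-+ : {A : Set} (ρ : A → A) → ∀ j k x → iter ρ (j + k) x ≡ iter ρ k (iter ρ j x)
iter-+ ρ zero    k x = refl
iter-+ ρ (suc j) k x = iter-+ ρ j k (ρ x)

iter-commute : {A B : Set} {ρ : A → A} {ρ′ : B → B} (g : A → B) → (∀ x → g (ρ x) ≡ ρ′ (g x)) →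
               ∀ j x → g (iter ρ j x) ≡ iter ρ′ j (g x)
iter-commute g comm zero    x = refl
iter-commute {ρ = ρ} {ρ′} g comm (suc j) x =
  trans (iter-commute g comm j (ρ x)) (cong (iter ρ′ j) (comm x))

module Rotation {Ω : Set} (ρ : Ω → Ω) (h : Ω → ℕ) where

  rot : ℕ → Ω → Ω
  rot = iter ρ

  -- Only the value of `h` at each rotation enters, so the cycle lemma needs no positions on a
  -- circle. For configurations this is a prefix sum of the car counts, by `height-prefix`.
  height : Ω → ℕ → ℕ
  height ω zero    = 0
  height ω (suc k) = h ω + height (ρ ω) k

  height-+ : ∀ j k ω → height ω (j + k) ≡ height ω j + height (rot j ω) k
  height-+ zero    k ω = refl
  height-+ (suc j) k ω =
    trans (cong (h ω ℕ.+_) (height-+ j k (ρ ω))) (sym (ℕ.+-assoc (h ω) _ _))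

  Parking : ℕ → Ω → Set
  Parking r ω = ∀ {k} → k ≤ r → k ≤ height ω k

-- A full turn of length r + 1 has height r, so exactly one rotation of each ω is parking:
-- the one that starts at the first minimum of height ω m − m.
module CycleLemma {Ω : Set} (ρ : Ω → Ω) (h : Ω → ℕ) (r : ℕ)
  (period : ∀ ω → iter ρ (suc r) ω ≡ ω)
  (full-turn : ∀ ω → Rotation.height ρ h ω (suc r) ≡ r) where

  open Rotation ρ h

  private
    N = suc r

    -- The two starting points cut the circle into arcs of lengths `gap` and `N ∸ gap`, both at most
    -- `r`. If both starts park, each arc is at least as high as it is long, so a full turn would
    -- have height at least `r + 1`.
    parking-≮ : ∀ {ω j j′} → j ≤ r → j′ ≤ r → Parking r (rot j ω) →
                Parking r (rot j′ ω) → ¬ j < j′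
    parking-≮ {ω} {j} {j′} j≤r j′≤r park park′ j<j′ = ℕ.<-irrefl refl (begin-strict
      r                                             <⟨ ℕ.n<1+n r ⟩
      N                                             ≡⟨ ℕ.m+[n∸m]≡n gap≤N ⟨
      gap + (N ∸ gap)                               ≤⟨ ℕ.+-mono-≤ (park gap≤r) (park″ N∸gap≤r) ⟩
      height (rot j ω) gap + height (rot gap (rot j ω)) (N ∸ gap)
                                                    ≡⟨ height-+ gap (N ∸ gap) (rot j ω) ⟨
      height (rot j ω) (gap + (N ∸ gap))            ≡⟨ cong (height (rot j ω)) (ℕ.m+[n∸m]≡n gap≤N) ⟩
      height (rot j ω) N                            ≡⟨ full-turn (rot j ω) ⟩
      r                                             ∎)
      where
      open ℕ.≤-Reasoning
      gap = j′ ∸ j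
      gap≤r = ℕ.≤-trans (ℕ.m∸n≤m j′ j) j′≤r
      gap≤N = ℕ.m≤n⇒m≤1+n gap≤r
      N∸gap≤r : N ∸ gap ≤ r
      N∸gap≤r = ℕ.∸-monoʳ-≤ N (ℕ.m<n⇒0<n∸m j<j′)
      park″ : Parking r (rot gap (rot j ω))
      park″ = subst (Parking r) (trans (cong (λ m → rot m ω) (sym (ℕ.m+[n∸m]≡n (ℕ.<⇒≤ j<j′))))
                                       (iter-+ ρ j gap ω)) park′

  parking-unique : ∀ {ω j j′} → j ≤ r → j′ ≤ r → Parking r (rot j ω) →
                   Parking r (rot j′ ω) → j ≡ j′
  parking-unique {j = j} {j′} j≤r j′≤r park park′ with ℕ.<-cmp j j′
  ... | tri< j<j′ _ _ = contradiction j<j′ (parking-≮ j≤r j′≤r park park′)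
  ... | tri≈ _ eq _   = eq
  ... | tri> _ _ j′<j = contradiction j′<j (parking-≮ j′≤r j≤r park′ park)

  private
    -- height ω m − m, shifted by 2 N to stay natural for m ≤ 2 N.
    excess : Ω → ℕ → ℕ
    excess ω m = height ω m + ((N + N) ∸ m)

  parking-exists : ∀ ω → ∃[ j ] j ≤ r × Parking r (rot j ω)
  parking-exists ω with first-minimum (excess ω) r
  ... | j , j≤r , least , first = j , j≤r , park
    where
    excess-turn : ∀ {m} → m ≤ N → excess ω m ≡ suc (excess ω (m + N))
    excess-turn {m} m≤N = begin
      height ω m + ((N + N) ∸ m)       ≡⟨ cong (height ω m ℕ.+_) (ℕ.+-∸-assoc N m≤N) ⟩
      height ω m + (N + (N ∸ m))       ≡⟨ ℕ.+-assoc (height ω m) N _ ⟨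
      height ω m + N + (N ∸ m)         ≡⟨ cong (_+ (N ∸ m)) (ℕ.+-suc (height ω m) r) ⟩
      suc (height ω m + r + (N ∸ m))
        ≡⟨ cong₂ (λ a b → suc (height ω m + a + b)) (full-turn (rot m ω))
                 (trans (cong ((N + N) ∸_) (ℕ.+-comm m N)) (ℕ.[m+n]∸[m+o]≡n∸o N N m)) ⟨
      suc (height ω m + height (rot m ω) N + ((N + N) ∸ (m + N)))
        ≡⟨ cong (λ a → suc (a + ((N + N) ∸ (m + N)))) (height-+ m N ω) ⟨
      suc (excess ω (m + N))             ∎
      where open ≡-Reasoning

    ahead : ∀ {k} → k ≤ r → excess ω j ≤ excess ω (j + k)
    ahead {k} k≤r with j + k ℕ.≤? r
    ... | yes j+k≤r = least j+k≤r
    -- Beyond the window `j + k` is `back + N` with `back` before the first minimum. A full turn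
    -- lowers the excess by one, and the strict inequality at `back` makes up for it.
    ... | no j+k≰r = ℕ.s≤s⁻¹ (begin-strict
      excess ω j                <⟨ first back<j ⟩
      excess ω back             ≡⟨ excess-turn (ℕ.≤-trans (ℕ.<⇒≤ back<j) (ℕ.m≤n⇒m≤1+n j≤r)) ⟩
      suc (excess ω (back + N)) ≡⟨ cong (λ m → suc (excess ω m)) (ℕ.m∸n+n≡m (ℕ.≰⇒> j+k≰r)) ⟩
      suc (excess ω (j + k))    ∎)
      where
      open ℕ.≤-Reasoning
      back = (j + k) ∸ N
      back<j : back < j
      back<j = ℕ.+-cancelʳ-< N back j (begin-strict
        back + N ≡⟨ ℕ.m∸n+n≡m (ℕ.≰⇒> j+k≰r) ⟩
        j + k    <⟨ ℕ.+-monoʳ-< j (s≤s k≤r) ⟩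
        j + N    ∎)

    park : Parking r (rot j ω)
    park {k} k≤r = ℕ.+-cancelʳ-≤ (height ω j + rest) k (height (rot j ω) k) (begin
      k + (height ω j + rest)                       ≡⟨ x∙yz≈y∙xz k (height ω j) rest ⟩
      height ω j + (k + rest)                       ≡⟨ cong (height ω j ℕ.+_) split ⟨
      excess ω j                                    ≤⟨ ahead k≤r ⟩
      height ω (j + k) + rest                       ≡⟨ cong (_+ rest) (height-+ j k ω) ⟩
      height ω j + height (rot j ω) k + rest        ≡⟨ cong (_+ rest) (ℕ.+-comm (height ω j) _) ⟩
      height (rot j ω) k + height ω j + rest        ≡⟨ ℕ.+-assoc (height (rot j ω) k) _ _ ⟩
      height (rot j ω) k + (height ω j + rest)      ∎)
      where
      open ℕ.≤-Reasoning
      rest = (N + N) ∸ (j + k)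
      k≤ : k ≤ (N + N) ∸ j
      k≤ = ℕ.m+n≤o⇒m≤o∸n k (ℕ.+-mono-≤ (ℕ.m≤n⇒m≤1+n k≤r) (ℕ.m≤n⇒m≤1+n j≤r))
      split : (N + N) ∸ j ≡ k + rest
      split = sym (trans (cong (k ℕ.+_) (sym (ℕ.∸-+-assoc (N + N) j k))) (ℕ.m+[n∸m]≡n k≤))

  module _ {M} (enum : Fin M ↔ Ω) (parking? : ∀ ω → Dec (Parking r ω)) where
    open Inverse enum renaming (to to decode; from to encode)

    parkingCode? : Decidable (λ x → Parking r (decode x))
    parkingCode? x = parking? (decode x)

    private
      T = count parkingCode?

      start : ∀ ω → Fin N
      start ω = Fin.fromℕ< (s≤s (proj₁ (proj₂ (parking-exists ω))))

      start-parks : ∀ ω → Parking r (rot (toℕ (start ω)) ω)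
      start-parks ω = subst (λ j → Parking r (rot j ω))
        (sym (Fin.toℕ-fromℕ< (s≤s (proj₁ (proj₂ (parking-exists ω))))))
        (proj₂ (proj₂ (parking-exists ω)))

      rot-back : ∀ {j} → j ≤ N → ∀ ω → rot (N ∸ j) (rot j ω) ≡ ω
      rot-back {j} j≤N ω = trans (sym (iter-+ ρ j (N ∸ j) ω))
        (trans (cong (λ m → rot m ω) (ℕ.m+[n∸m]≡n j≤N)) (period ω))

      rot-forth : ∀ {j} → j ≤ N → ∀ ω → rot j (rot (N ∸ j) ω) ≡ ω
      rot-forth {j} j≤N ω = trans (sym (iter-+ ρ (N ∸ j) j ω))
        (trans (cong (λ m → rot m ω) (ℕ.m∸n+n≡m j≤N)) (period ω))

      place : Fin T × Fin N → Ω
      -- Turning by `N ∸ j` undoes a turn by `j`, so `j` is the turn that makes the result park.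
      place (x , j) = rot (N ∸ toℕ j) (decode (nth parkingCode? x))

      turns : ∀ (j : Fin N) → toℕ j ≤ N
      turns j = ℕ.<⇒≤ (Fin.toℕ<n j)

      place-injective : ∀ {u v} → place u ≡ place v → u ≡ v
      place-injective {x , j} {x′ , j′} eq with Fin.toℕ-injective j≡j′
        where
        parks : ∀ x j → Parking r (rot (toℕ j) (place (x , j)))
        parks x j = subst (Parking r) (sym (rot-forth (turns j) _)) (nth-sound parkingCode? x)
        j≡j′ : toℕ j ≡ toℕ j′
        j≡j′ = parking-unique (Fin.toℕ≤pred[n] j) (Fin.toℕ≤pred[n] j′) (parks x j)
          (subst (λ ω → Parking r (rot (toℕ j′) ω)) (sym eq) (parks x′ j′))
      ... | refl = cong (_, j) (nth-injective parkingCode? (to-injective enum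
        (trans (sym (rot-forth (turns j) _)) (trans (cong (rot (toℕ j)) eq) (rot-forth (turns j) _)))))

      place-surjective : ∀ ω → ∃[ u ] place u ≡ ω
      place-surjective ω = (proj₁ found , start ω) ,
        trans (cong (rot (N ∸ toℕ (start ω)))
                    (trans (cong decode (proj₂ found)) (strictlyInverseˡ _)))
              (rot-back (turns (start ω)) ω)
        where
        found = nth-complete parkingCode? {encode (rot (toℕ (start ω)) ω)}
          (subst (Parking r) (sym (strictlyInverseˡ _)) (start-parks ω))

    -- Through `place`, the pairs of a parking code and an amount of turning biject with `Ω`:
    -- uniqueness of the parking rotation recovers the turning, and its existence gives
    -- surjectivity.
    count-parking : T *ℕ N ≡ M
    count-parking = Fin.cantor-schröder-bernstein
      {f = encode ∘ place ∘ Fin.remQuot {T} N}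
      {g = Inverse.from Fin.*↔× ∘ proj₁ ∘ place-surjective ∘ decode}
      (λ eq → to-injective Fin.*↔× (place-injective (to-injective (↔-sym enum) eq)))
      (λ {a} {b} eq → to-injective enum
        (trans (sym (proj₂ (place-surjective (decode a))))
        (trans (cong place (to-injective (↔-sym Fin.*↔×) eq))
               (proj₂ (place-surjective (decode b))))))

-- Cars on a circle

prefix : Vec ℕ n → ℕ → ℕ
prefix []       k       = 0
prefix (x ∷ xs) zero    = 0
prefix (x ∷ xs) (suc k) = x + prefix xs k

prefix-zero : (v : Vec ℕ n) → prefix v 0 ≡ 0
prefix-zero []      = refl
prefix-zero (_ ∷ _) = refl

prefix-suc : (v : Vec ℕ n) (j : Fin n) → prefix v (suc (toℕ j)) ≡ prefix v (toℕ j) + lookup v j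
prefix-suc (x ∷ v) zero    = trans (cong (x ℕ.+_) (prefix-zero v)) (ℕ.+-identityʳ x)
prefix-suc (x ∷ v) (suc j) = trans (cong (x ℕ.+_) (prefix-suc v j)) (sym (ℕ.+-assoc x _ _))

prefix-all : (v : Vec ℕ n) → prefix v n ≡ sum v
prefix-all []      = refl
prefix-all (x ∷ v) = cong (x ℕ.+_) (prefix-all v)

prefix-∷ʳ : (v : Vec ℕ n) (x : ℕ) → k ≤ n → prefix (v ∷ʳ x) k ≡ prefix v k
prefix-∷ʳ []      x z≤n       = refl
prefix-∷ʳ (y ∷ v) x z≤n       = refl
prefix-∷ʳ (y ∷ v) x (s≤s k≤n) = cong (y ℕ.+_) (prefix-∷ʳ v x k≤n)

infixl 6 _⊕_

_⊕_ : Vec ℕ n → Vec ℕ n → Vec ℕ n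
_⊕_ = zipWith _+_

prefix-⊕ : (u v : Vec ℕ n) (k : ℕ) → prefix (u ⊕ v) k ≡ prefix u k + prefix v k
prefix-⊕ []      []      k       = refl
prefix-⊕ (x ∷ u) (y ∷ v) zero    = refl
prefix-⊕ (x ∷ u) (y ∷ v) (suc k) =
  trans (cong (x + y ℕ.+_) (prefix-⊕ u v k)) (interchange x y _ _)

sum-⊕ : (u v : Vec ℕ n) → sum (u ⊕ v) ≡ sum u + sum v
sum-⊕ u v = trans (sym (prefix-all (u ⊕ v)))
  (trans (prefix-⊕ u v _) (cong₂ _+_ (prefix-all u) (prefix-all v)))

sum-∷ʳ : (v : Vec ℕ n) (x : ℕ) → sum (v ∷ʳ x) ≡ x + sum v
sum-∷ʳ []      x = refl
sum-∷ʳ (y ∷ v) x = trans (cong (y ℕ.+_) (sum-∷ʳ v x)) (x∙yz≈y∙xz y x (sum v))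

unit : Fin n → Vec ℕ n
unit zero    = 1 ∷ replicate _ 0
unit (suc x) = 0 ∷ unit x

unit-injective : {x y : Fin n} → unit x ≡ unit y → x ≡ y
unit-injective {x = zero}  {zero}  _  = refl
unit-injective {x = suc x} {suc y} eq = cong suc (unit-injective (Vec.∷-injectiveʳ eq))

-- A sum of unit vectors rather than a table of counts: rotation and total distribute over `⊕`, and
-- `lookup-tally` recovers the counts.
tally : Vec (Fin n) i → Vec ℕ n
tally []      = replicate _ 0
tally (x ∷ f) = unit x ⊕ tally f

sum-zeros : ∀ n → sum (replicate n 0) ≡ 0
sum-zeros zero    = refl
sum-zeros (suc n) = sum-zeros n

sum-unit : (x : Fin n) → sum (unit x) ≡ 1
sum-unit {suc n} zero = cong suc (sum-zeros n)
sum-unit (suc x)      = sum-unit x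

sum-tally : (f : Vec (Fin n) i) → sum (tally f) ≡ i
sum-tally {n} []  = sum-zeros n
sum-tally (x ∷ f) = trans (sum-⊕ (unit x) (tally f)) (cong₂ _+_ (sum-unit x) (sum-tally f))

lookup-unit : (x c : Fin n) → lookup (unit x) c ≡ length (filter (Fin._≟ c) (x ∷ []))
lookup-unit zero    zero    = refl
lookup-unit zero    (suc c) = Vec.lookup-replicate c 0
lookup-unit (suc x) zero    = refl
lookup-unit (suc x) (suc c) with x Fin.≟ c | lookup-unit x c
... | yes _ | eq = eq
... | no _  | eq = eq

lookup-tally : (f : Vec (Fin n) i) (c : Fin n) →
               lookup (tally f) c ≡ count (λ x → lookup f x Fin.≟ c)
lookup-tally []      c = Vec.lookup-replicate c 0
lookup-tally (x ∷ f) c = begin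
  lookup (unit x ⊕ tally f) c
    ≡⟨ Vec.lookup-zipWith _+_ c (unit x) (tally f) ⟩
  lookup (unit x) c + lookup (tally f) c
    ≡⟨ cong₂ _+_ (trans (lookup-unit x c) head-count) (lookup-tally f c) ⟩
  length (filter here? (zero ∷ [])) + count (here? ∘ suc)
    ≡⟨ count-suc here? ⟨
  count here? ∎
  where
  open ≡-Reasoning
  here? : Decidable (λ z → lookup (x ∷ f) z ≡ c)
  here? z = lookup (x ∷ f) z Fin.≟ c
  head-count : length (filter (Fin._≟ c) (x ∷ [])) ≡ length (filter here? (zero ∷ []))
  head-count with x Fin.≟ c
  ... | yes _ = refl
  ... | no _  = refl

rotate : {A : Set} → Vec A (suc n) → Vec A (suc n)
rotate (x ∷ v) = v ∷ʳ x

rotateList : {A : Set} → List A → List A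
rotateList []       = []
rotateList (x ∷ xs) = xs List.++ (x ∷ [])

-- The extra block `ys` makes the induction go through: one turn moves the head of `xs` behind `ys`.
-- On lists the blocks can be reassociated without changing a length index.
iter-rotateList : {A : Set} (xs ys : List A) →
                  iter rotateList (length xs) (xs List.++ ys) ≡ ys List.++ xs
iter-rotateList []       ys = sym (List.++-identityʳ ys)
iter-rotateList (x ∷ xs) ys = begin
  iter rotateList (length xs) ((xs List.++ ys) List.++ (x ∷ []))
    ≡⟨ cong (iter rotateList (length xs)) (List.++-assoc xs ys _) ⟩
  iter rotateList (length xs) (xs List.++ (ys List.++ (x ∷ [])))
    ≡⟨ iter-rotateList xs _ ⟩
  (ys List.++ (x ∷ [])) List.++ xs
    ≡⟨ List.++-assoc ys _ xs ⟩
  ys List.++ (x ∷ xs) ∎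
  where open ≡-Reasoning

rotate-period : {A : Set} (v : Vec A (suc n)) → iter rotate (suc n) v ≡ v
rotate-period {n} v = toList-inj (begin
  toList (iter rotate (suc n) v)
    ≡⟨ iter-commute toList toList-rotate (suc n) v ⟩
  iter rotateList (suc n) (toList v)
    ≡⟨ cong (λ m → iter rotateList m (toList v)) (Vec.length-toList v) ⟨
  iter rotateList (length (toList v)) (toList v)
    ≡⟨ cong (iter rotateList (length (toList v))) (List.++-identityʳ (toList v)) ⟨
  iter rotateList (length (toList v)) (toList v List.++ [])
    ≡⟨ iter-rotateList (toList v) [] ⟩
  toList v ∎)
  where
  open ≡-Reasoning
  toList-inj : {u w : Vec _ (suc n)} → toList u ≡ toList w → u ≡ w
  toList-inj {u = u} {w} eq = trans (sym (Vec.cast-is-id refl u)) (Vec.toList-injective refl u w eq)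
  toList-rotate : (w : Vec _ (suc n)) → toList (rotate w) ≡ rotateList (toList w)
  toList-rotate (x ∷ w) = Vec.toList-∷ʳ x w

sum-rotate : (v : Vec ℕ (suc n)) → sum (rotate v) ≡ sum v
sum-rotate (x ∷ v) = sum-∷ʳ v x

rotate-⊕ : (u v : Vec ℕ (suc n)) → rotate (u ⊕ v) ≡ rotate u ⊕ rotate v
rotate-⊕ (x ∷ u) (y ∷ v) = go u v
  where
  go : ∀ {n} (u v : Vec ℕ n) → (u ⊕ v) ∷ʳ (x + y) ≡ (u ∷ʳ x) ⊕ (v ∷ʳ y)
  go []      []      = refl
  go (_ ∷ u) (_ ∷ v) = cong (_ ∷_) (go u v)

replicate-∷ʳ : ∀ n → replicate n 0 ∷ʳ 0 ≡ replicate (suc n) 0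
replicate-∷ʳ zero    = refl
replicate-∷ʳ (suc n) = cong (0 ∷_) (replicate-∷ʳ n)

shift : Fin (suc n) → Fin (suc n)
shift zero    = fromℕ _
shift (suc x) = inject₁ x

rotate-unit : (x : Fin (suc n)) → rotate (unit x) ≡ unit (shift x)
rotate-unit {n} zero = go n
  where
  go : ∀ n → replicate n 0 ∷ʳ 1 ≡ unit (fromℕ n)
  go zero    = refl
  go (suc n) = cong (0 ∷_) (go n)
rotate-unit (suc x) = go x
  where
  go : (x : Fin n) → unit x ∷ʳ 0 ≡ unit (inject₁ x)
  go zero    = cong (1 ∷_) (replicate-∷ʳ _)
  go (suc x) = cong (0 ∷_) (go x)

-- Transported from `rotate-period` along the injection `unit`, in place of modular arithmetic on
-- `Fin`.
shift-period : (x : Fin (suc n)) → iter shift (suc n) x ≡ x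
shift-period {n} x = unit-injective (trans
  (iter-commute unit (sym ∘ rotate-unit) (suc n) x) (rotate-period (unit x)))

rotate-tally : (f : Vec (Fin (suc n)) i) → rotate (tally f) ≡ tally (map shift f)
rotate-tally {n} []      = replicate-∷ʳ n
rotate-tally     (x ∷ f) =
  trans (rotate-⊕ (unit x) (tally f)) (cong₂ _⊕_ (rotate-unit x) (rotate-tally f))

map-shift-period : (f : Vec (Fin (suc n)) i) → iter (map shift) (suc n) f ≡ f
map-shift-period {n} f = trans (go (suc n) f)
  (trans (Vec.map-cong shift-period f) (Vec.map-id f))
  where
  go : ∀ m (f : Vec (Fin (suc n)) k) → iter (map shift) m f ≡ map (iter shift m) f
  go zero    f = sym (Vec.map-id f)
  go (suc m) f = trans (go m (map shift f)) (sym (Vec.map-∘ (iter shift m) shift f))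

-- Enumeration of configurations

Composition : ℕ → ℕ → Set
Composition a n = Σ[ y ∈ Vec ℕ n ] sum y ≡ a

Composition-≡ : ∀ {a} {y y′ : Composition a n} → proj₁ y ≡ proj₁ y′ → y ≡ y′
Composition-≡ {y = y , eq} {.y , eq′} refl = cong (y ,_) (ℕ.≡-irrelevant eq eq′)

-- Stars and bars by Pascal's rule: a first entry 0 is dropped, a positive first entry is lowered by
-- one.
Composition↔Fin : ∀ a r → Composition a (suc r) ↔ Fin ((a + r) C r)
Composition↔Fin a zero = mk↔ₛ′ (λ _ → zero) (λ _ → a ∷ [] , ℕ.+-identityʳ a)
  (λ { zero → refl })
  (λ { (x ∷ [] , eq) → Composition-≡ (cong (_∷ []) (trans (sym eq) (ℕ.+-identityʳ x))) })
Composition↔Fin zero (suc r) = subst (λ c → Composition 0 (suc (suc r)) ↔ Fin c)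
  (trans (nCn≡1 r) (sym (nCn≡1 (suc r))))
  (↔-trans drop (Composition↔Fin zero r))
  where
  drop : Composition 0 (suc (suc r)) ↔ Composition 0 (suc r)
  drop = mk↔ₛ′ (λ { (zero ∷ y , eq) → y , eq }) (λ (y , eq) → 0 ∷ y , eq)
    (λ _ → refl) (λ { (zero ∷ y , eq) → refl })
Composition↔Fin (suc a) (suc r) = subst (λ c → Composition (suc a) (suc (suc r)) ↔ Fin c)
  (trans (cong (λ m → m C r + (a + suc r) C (suc r)) (sym (ℕ.+-suc a r)))
         (nCk+nC[k+1]≡[n+1]C[k+1] (a + suc r) r))
  (↔-trans split (↔-trans (Composition↔Fin (suc a) r ⊎-↔ Composition↔Fin a (suc r)) (↔-sym Fin.+↔⊎)))
  where
  split : Composition (suc a) (suc (suc r)) ↔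
          (Composition (suc a) (suc r) ⊎ Composition a (suc (suc r)))
  split = mk↔ₛ′
    (λ { (zero ∷ y , eq) → inj₁ (y , eq) ; (suc x ∷ y , eq) → inj₂ (x ∷ y , ℕ.suc-injective eq) })
    (λ { (inj₁ (y , eq)) → 0 ∷ y , eq ; (inj₂ (x ∷ y , eq)) → suc x ∷ y , cong suc eq })
    (λ { (inj₁ (y , eq)) → refl ; (inj₂ (x ∷ y , eq)) → cong inj₂ (Composition-≡ refl) })
    (λ { (zero ∷ y , eq) → refl ; (suc x ∷ y , eq) → Composition-≡ refl })

Vec↔Fin : ∀ n i → Vec (Fin n) i ↔ Fin (n ^ i)
Vec↔Fin n zero    = mk↔ₛ′ (λ _ → zero) (λ _ → []) (λ { zero → refl }) (λ { [] → refl })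
Vec↔Fin n (suc i) = ↔-trans uncons (↔-trans (↔-refl ×-↔ Vec↔Fin n i) (↔-sym Fin.*↔×))
  where
  uncons : Vec (Fin n) (suc i) ↔ (Fin n × Vec (Fin n) i)
  uncons = mk↔ₛ′ (λ { (x ∷ f) → x , f }) (λ (x , f) → x ∷ f) (λ _ → refl) (λ { (x ∷ f) → refl })

-- A configuration distributes i labelled and a unlabelled cars over n spots.
Config : (n i a : ℕ) → Set
Config n i a = Vec (Fin n) i × Composition a n

Config↔Fin : ∀ r i a → Config (suc r) i a ↔ Fin (suc r ^ i *ℕ ((a + r) C r))
Config↔Fin r i a = ↔-trans (Vec↔Fin (suc r) i ×-↔ Composition↔Fin a r) (↔-sym Fin.*↔×)

Config-≡ : ∀ {a} {ω ω′ : Config n i a} → proj₁ ω ≡ proj₁ ω′ →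
           proj₁ (proj₂ ω) ≡ proj₁ (proj₂ ω′) → ω ≡ ω′
Config-≡ refl y≡y′ = cong (_ ,_) (Composition-≡ y≡y′)

cars : ∀ {a} → Config n i a → Vec ℕ n
cars (f , y , _) = tally f ⊕ y

turn : ∀ {a} → Config (suc n) i a → Config (suc n) i a
turn (f , y , eq) = map shift f , rotate y , trans (sum-rotate y) eq

cars-turn : ∀ {a} (ω : Config (suc n) i a) → cars (turn ω) ≡ rotate (cars ω)
cars-turn (f , y , _) = trans (cong (_⊕ rotate y) (sym (rotate-tally f))) (sym (rotate-⊕ (tally f) y))

turn-period : ∀ {a} (ω : Config (suc n) i a) → iter turn (suc n) ω ≡ ω
turn-period {n} ω = Config-≡
  (trans (iter-commute proj₁ (λ _ → refl) (suc n) ω) (map-shift-period (proj₁ ω)))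
  (trans (iter-commute (proj₁ ∘ proj₂) (λ _ → refl) (suc n) ω) (rotate-period (proj₁ (proj₂ ω))))

module _ {n i a : ℕ} where
  open Rotation (turn {n} {i} {a}) (head ∘ cars)

  -- A turn moves the first entry behind the next `n` ones, out of reach of the remaining prefix, so
  -- the heads met while turning are the entries in order.
  height-prefix : ∀ ω → k ≤ suc n → height ω k ≡ prefix (cars ω) k
  height-prefix ω z≤n       = sym (prefix-zero (cars ω))
  height-prefix ω (s≤s {k} k≤n) = trans
    (cong (head (cars ω) ℕ.+_) (trans (height-prefix (turn ω) (ℕ.m≤n⇒m≤1+n k≤n))
                                    (cong (λ v → prefix v k) (cars-turn ω))))
    (go (cars ω))
    where
    go : ∀ v → head v + prefix (rotate v) k ≡ prefix v (suc k)
    go (x ∷ v) = cong (x ℕ.+_) (prefix-∷ʳ v x k≤n)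

-- With `r` cars in all, the case `k = r` puts every car on the first `r` spots: the last spot is
-- the one that stays empty in Pollak's argument.
ParkingConfig : ∀ {r i a} → Config (suc r) i a → Set
ParkingConfig {r} ω = ∀ {k} → k ≤ r → k ≤ prefix (cars ω) k

module ParkingConfigs {r i a : ℕ} (i+a≡r : i + a ≡ r) where
  open Rotation (turn {r} {i} {a}) (head ∘ cars)

  turn-height : ∀ ω → height ω (suc r) ≡ r
  turn-height ω@(f , y , eq) = begin
    height ω (suc r)        ≡⟨ height-prefix ω ℕ.≤-refl ⟩
    prefix (cars ω) (suc r) ≡⟨ prefix-all (cars ω) ⟩
    sum (tally f ⊕ y)       ≡⟨ sum-⊕ (tally f) y ⟩
    sum (tally f) + sum y   ≡⟨ cong₂ _+_ (sum-tally f) eq ⟩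
    i + a                   ≡⟨ i+a≡r ⟩
    r                       ∎
    where open ≡-Reasoning

  parking? : Decidable (Parking r)
  parking? ω = map′ (λ p k≤r → p (s≤s k≤r)) (λ p {k} k<N → p (ℕ.s≤s⁻¹ k<N))
    (ℕ.allUpTo? (λ k → k ℕ.≤? height ω k) (suc r))

  enum : Fin (suc r ^ i *ℕ ((a + r) C r)) ↔ Config (suc r) i a
  enum = ↔-sym (Config↔Fin r i a)

  open CycleLemma turn (head ∘ cars) r turn-period turn-height

  #parking : ℕ
  #parking = count (parkingCode? enum parking?)

  #parking-formula : #parking *ℕ suc r ≡ suc r ^ i *ℕ ((a + r) C r)
  #parking-formula = count-parking enum parking?

  parkingConfig : Fin #parking → Config (suc r) i a
  parkingConfig x = Inverse.to enum (nth (parkingCode? enum parking?) x)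

  parkingConfig-injective : Injective _≡_ _≡_ parkingConfig
  parkingConfig-injective = nth-injective (parkingCode? enum parking?) ∘ to-injective enum

  parkingConfig-sound : ∀ x → ParkingConfig (parkingConfig x)
  parkingConfig-sound x {k} k≤r = subst (k ≤_)
    (height-prefix (parkingConfig x) (ℕ.m≤n⇒m≤1+n k≤r)) (nth-sound (parkingCode? enum parking?) x k≤r)

  parkingConfig-complete : ∀ ω → ParkingConfig ω → ∃[ x ] parkingConfig x ≡ ω
  parkingConfig-complete ω park = proj₁ found ,
    trans (cong (Inverse.to enum) (proj₂ found)) (Inverse.strictlyInverseˡ enum ω)
    where
    found = nth-complete (parkingCode? enum parking?) {Inverse.from enum ω}
      (subst (Parking r) (sym (Inverse.strictlyInverseˡ enum ω))
        (λ {k} k≤r → subst (k ≤_) (sym (height-prefix ω (ℕ.m≤n⇒m≤1+n k≤r))) (park k≤r)))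

-- Netflows and partial sums

+≡⇒≡- : ∀ {x y z} → x + z ≡ y → + x ≡ + y ℤ.- + z
+≡⇒≡- {x} {z = z} refl = begin
  + x                          ≡⟨ ℤ.+-identityʳ (+ x) ⟨
  + x ℤ.+ 0ℤ                   ≡⟨ cong (λ u → + x ℤ.+ u) (ℤ.+-inverseʳ (+ z)) ⟨
  + x ℤ.+ (+ z ℤ.- + z)        ≡⟨ ℤ.+-assoc (+ x) (+ z) (ℤ.- + z) ⟨
  (+ x ℤ.+ + z) ℤ.- + z        ≡⟨ cong (ℤ._- + z) (ℤ.pos-+ x z) ⟨
  + (x + z) ℤ.- + z            ∎
  where open ≡-Reasoning

≡-⇒+≡ : ∀ {x y z} → + x ≡ + y ℤ.- + z → x + z ≡ y
≡-⇒+≡ {x} {y} {z} eq = ℤ.+-injective (begin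
  + (x + z)                    ≡⟨ ℤ.pos-+ x z ⟩
  + x ℤ.+ + z                  ≡⟨ cong (ℤ._+ + z) eq ⟩
  (+ y ℤ.- + z) ℤ.+ + z        ≡⟨ ℤ.+-assoc (+ y) (ℤ.- + z) (+ z) ⟩
  + y ℤ.+ (ℤ.- + z ℤ.+ + z)    ≡⟨ cong (λ u → + y ℤ.+ u) (ℤ.+-inverseˡ (+ z)) ⟩
  + y ℤ.+ 0ℤ                   ≡⟨ ℤ.+-identityʳ (+ y) ⟩
  + y                          ∎)
  where open ≡-Reasoning

partialSum-cong : {f g : Fin n → ℤ} → (∀ j → f j ≡ g j) → ∀ k → partialSum f k ≡ partialSum g k
partialSum-cong f≡g zero    = f≡g zero
partialSum-cong f≡g (suc k) = cong₂ ℤ._+_ (f≡g zero) (partialSum-cong (f≡g ∘ suc) k)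

partialSum-injective : {f g : Fin n → ℤ} → (∀ k → partialSum f k ≡ partialSum g k) → ∀ j → f j ≡ g j
partialSum-injective {f = f} {g} eq zero = eq zero
partialSum-injective {f = f} {g} eq (suc j) = partialSum-injective
  (λ k → ℤ-cancelˡ (f zero) _ _ (trans (eq (suc k))
    (cong (ℤ._+ partialSum (g ∘ suc) k) (sym (eq zero))))) j

sum≡partialSum : (f : Fin (suc n) → ℤ) → ∑.sum f ≡ partialSum f (fromℕ n)
sum≡partialSum {zero}  f = ℤ.+-identityʳ (f zero)
sum≡partialSum {suc n} f = cong (λ u → f zero ℤ.+ u) (sum≡partialSum (f ∘ suc))

partialSum-minus : (f g : Fin n → ℤ) → ∀ k →
               partialSum (λ j → f j ℤ.- g j) k ≡ partialSum f k ℤ.- partialSum g k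
partialSum-minus f g zero    = refl
partialSum-minus f g (suc k) = begin
  (f zero ℤ.- g zero) ℤ.+ partialSum (λ j → f (suc j) ℤ.- g (suc j)) k
    ≡⟨ cong (λ u → (f zero ℤ.- g zero) ℤ.+ u) (partialSum-minus (f ∘ suc) (g ∘ suc) k) ⟩
  (f zero ℤ.- g zero) ℤ.+ (F ℤ.- G)
    ≡⟨ ℤ-interchange (f zero) (ℤ.- g zero) F (ℤ.- G) ⟩
  (f zero ℤ.+ F) ℤ.+ (ℤ.- g zero ℤ.- G)
    ≡⟨ cong (λ u → (f zero ℤ.+ F) ℤ.+ u) (ℤ.neg-distrib-+ (g zero) G) ⟨
  (f zero ℤ.+ F) ℤ.- (g zero ℤ.+ G) ∎
  where
  open ≡-Reasoning
  F = partialSum (f ∘ suc) k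
  G = partialSum (g ∘ suc) k

partialSum-lookup : (s : Vec ℕ n) → ∀ k → partialSum (λ j → + lookup s j) k ≡ + prefix s (suc (toℕ k))
partialSum-lookup (x ∷ s) zero    =
  cong +_ (sym (trans (cong (λ u → x + u) (prefix-zero s)) (ℕ.+-identityʳ x)))
partialSum-lookup (x ∷ s) (suc k) =
  trans (cong (λ u → + x ℤ.+ u) (partialSum-lookup s k)) (sym (ℤ.pos-+ x _))

expansion : (Fin n → ℕ) → Fin (suc n) → ℤ
expansion {n} d j = ∑[ k < n ] (+ d k ℤ.* α k j)

private
  sum-zero : {f : Fin n → ℤ} → (∀ k → f k ≡ 0ℤ) → ∑.sum f ≡ 0ℤ
  sum-zero {n} f≡0 = trans (∑.sum-cong-≗ f≡0) (∑.sum-replicate-zero n)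

  expansion-zero : (d : Fin (suc n) → ℕ) → expansion d zero ≡ + d zero
  expansion-zero d = trans
    (cong₂ ℤ._+_ (ℤ.*-identityʳ (+ d zero)) (sum-zero (λ k → ℤ.*-zeroʳ (+ d (suc k)))))
    (ℤ.+-identityʳ (+ d zero))

  -- Past its first entry `α zero` is `- e zero`. Its multiple by `c` enters the partial sums at
  -- once as `- c` and stays there, ready to cancel the first entry of the expansion.
  partialSum-drop : (c : ℤ) (g : Fin (suc n) → ℤ) → ∀ k →
    partialSum (λ j → c ℤ.* (0ℤ ℤ.- e zero j) ℤ.+ g j) k ≡ ℤ.- c ℤ.+ partialSum g k
  partialSum-drop c g = go
    where
    at-zero : c ℤ.* (0ℤ ℤ.- 1ℤ) ≡ ℤ.- c
    at-zero = trans (ℤ.*-comm c (ℤ.- 1ℤ)) (ℤ.-1*i≡-i c)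
    later : ∀ x → c ℤ.* 0ℤ ℤ.+ x ≡ x
    later x = trans (cong (ℤ._+ x) (ℤ.*-zeroʳ c)) (ℤ.+-identityˡ x)
    go : ∀ k → partialSum (λ j → c ℤ.* (0ℤ ℤ.- e zero j) ℤ.+ g j) k ≡ ℤ.- c ℤ.+ partialSum g k
    go zero    = cong (ℤ._+ g zero) at-zero
    go (suc k) = trans
      (cong₂ ℤ._+_ (cong (ℤ._+ g zero) at-zero) (partialSum-cong (λ j → later (g (suc j))) k))
      (ℤ.+-assoc (ℤ.- c) (g zero) _)

  partialSum-expansion-suc : (d : Fin (suc n) → ℕ) → ∀ k →
    partialSum (expansion d) (suc k) ≡ partialSum (expansion (d ∘ suc)) k
  partialSum-expansion-suc d k = begin
    expansion d zero ℤ.+ partialSum (expansion d ∘ suc) k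
      ≡⟨ cong₂ ℤ._+_ (expansion-zero d) (partialSum-drop (+ d zero) (expansion (d ∘ suc)) k) ⟩
    + d zero ℤ.+ (ℤ.- + d zero ℤ.+ S)
      ≡⟨ ℤ.+-assoc (+ d zero) (ℤ.- + d zero) S ⟨
    (+ d zero ℤ.- + d zero) ℤ.+ S
      ≡⟨ cong (ℤ._+ S) (ℤ.+-inverseʳ (+ d zero)) ⟩
    0ℤ ℤ.+ S
      ≡⟨ ℤ.+-identityˡ S ⟩
    S ∎
    where
    open ≡-Reasoning
    S = partialSum (expansion (d ∘ suc)) k

-- The partial sums of `α k` are 1 at position `k` and 0 elsewhere, so taking partial sums reads off
-- the coefficients.
partialSum-expansion : (d : Fin n → ℕ) → ∀ k → partialSum (expansion d) (inject₁ k) ≡ + d k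
partialSum-expansion d zero    = expansion-zero d
partialSum-expansion d (suc k) =
  trans (partialSum-expansion-suc d (inject₁ k)) (partialSum-expansion (d ∘ suc) k)

partialSum-expansion-last : (d : Fin n → ℕ) → partialSum (expansion d) (fromℕ n) ≡ 0ℤ
partialSum-expansion-last {zero}  d = refl
partialSum-expansion-last {suc n} d =
  trans (partialSum-expansion-suc d (fromℕ n)) (partialSum-expansion-last (d ∘ suc))

expansion-unique : (d : Fin n → ℕ) {v : Fin (suc n) → ℤ} →
  (∀ k → + d k ≡ partialSum v (inject₁ k)) → partialSum v (fromℕ n) ≡ 0ℤ → ∀ j → v j ≡ expansion d j
expansion-unique d {v} columns total = partialSum-injective go
  where
  go : ∀ k → partialSum v k ≡ partialSum (expansion d) k
  go k with view k
  ... | ‵fromℕ     = trans total (sym (partialSum-expansion-last d))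
  ... | ‵inject₁ k = trans (sym (columns k)) (sym (partialSum-expansion d k))

-- Out-degrees of the caracol graph and partial sums of its shift vector

module _ (r : ℕ) where

  outDegree-source : outDegree (Car r) zero ≡ suc r
  outDegree-source = sym (count-image (edge? (Car r) zero) {g = suc ∘ inject₁}
    (λ eq → Fin.inject₁-injective (Fin.suc-injective eq))
    (λ x → inj₁ (refl , s≤s (s≤s z≤n) ,
      s≤s (s≤s (subst (_≤ r) (sym (Fin.toℕ-inject₁ x)) (Fin.toℕ≤pred[n] x)))))
    complete)
    where
    complete : ∀ {y} → Edge (Car r) zero y → ∃[ x ] suc (inject₁ x) ≡ y
    complete {zero} (inj₁ (_ , s≤s () , _))
    complete {suc y} (inj₁ (_ , _ , s≤s y<N)) = Fin.fromℕ< y<N ,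
      cong suc (Fin.toℕ-injective (trans (Fin.toℕ-inject₁ _) (Fin.toℕ-fromℕ< y<N)))
    complete (inj₂ (inj₁ (s≤s () , _)))
    complete (inj₂ (inj₂ (s≤s () , _)))

  outDegree-middle : (c : Fin r) → outDegree (Car r) (inject₁ (suc (inject₁ c))) ≡ 2
  outDegree-middle c = sym (count-image (edge? (Car r) v) {g = g} g-injective sound complete)
    where
    v = inject₁ (suc (inject₁ c))
    v≡ : toℕ v ≡ suc (toℕ c)
    v≡ = cong suc (trans (Fin.toℕ-inject₁ _) (Fin.toℕ-inject₁ c))
    g : Fin 2 → Fin (3 + r)
    g zero       = suc (suc (inject₁ c))
    g (suc zero) = fromℕ (2 + r)
    c<r : toℕ (inject₁ c) < r
    c<r = subst (_< r) (sym (Fin.toℕ-inject₁ c)) (Fin.toℕ<n c)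
    g₀≢g₁ : g zero ≢ g (suc zero)
    g₀≢g₁ eq = ℕ.<⇒≢ c<r (trans (cong toℕ (Fin.suc-injective (Fin.suc-injective eq))) (Fin.toℕ-fromℕ r))
    g-injective : ∀ {x y} → g x ≡ g y → x ≡ y
    g-injective {zero}     {zero}     _  = refl
    g-injective {zero}     {suc zero} eq = contradiction eq g₀≢g₁
    g-injective {suc zero} {zero}     eq = contradiction (sym eq) g₀≢g₁
    g-injective {suc zero} {suc zero} _  = refl
    sound : ∀ x → Edge (Car r) v (g x)
    sound zero       = inj₂ (inj₁ (s≤s (subst (1 ≤_) (sym v≡) (s≤s z≤n)) ,
      s≤s (ℕ.≤-trans (ℕ.≤-reflexive v≡) (s≤s (ℕ.<⇒≤ (Fin.toℕ<n c)))) ,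
      cong (λ u → suc (suc u)) (trans (cong suc (Fin.toℕ-inject₁ c)) (sym v≡))))
    sound (suc zero) = inj₂ (inj₂ (s≤s (subst (1 ≤_) (sym v≡) (s≤s z≤n)) ,
      s≤s (s≤s (ℕ.≤-trans (ℕ.≤-reflexive v≡) (Fin.toℕ<n c))) ,
      cong (λ u → suc (suc (suc u))) (Fin.toℕ-fromℕ r)))
    complete : ∀ {y} → Edge (Car r) v y → ∃[ x ] g x ≡ y
    complete (inj₁ (v≡1 , _)) = contradiction (trans (sym v≡) (ℕ.suc-injective v≡1)) λ ()
    complete (inj₂ (inj₁ (_ , _ , eq))) = zero ,
      Fin.toℕ-injective (trans (cong (λ u → suc (suc u)) (Fin.toℕ-inject₁ c))
        (sym (trans (ℕ.suc-injective eq) (cong suc v≡))))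
    complete (inj₂ (inj₂ (_ , _ , eq))) = suc zero ,
      Fin.toℕ-injective (trans (Fin.toℕ-fromℕ _) (sym (ℕ.suc-injective eq)))

  outDegree-last : outDegree (Car r) (inject₁ (fromℕ (suc r))) ≡ 1
  outDegree-last = sym (count-image (edge? (Car r) v) {g = λ _ → fromℕ (2 + r)}
    (λ { {zero} {zero} _ → refl }) (λ _ → sound) complete)
    where
    v = inject₁ (fromℕ (suc r))
    v≡ : toℕ v ≡ suc r
    v≡ = trans (Fin.toℕ-inject₁ _) (Fin.toℕ-fromℕ (suc r))
    sound : Edge (Car r) v (fromℕ (2 + r))
    sound = inj₂ (inj₁ (s≤s (subst (1 ≤_) (sym v≡) (s≤s z≤n)) , s≤s (ℕ.≤-reflexive v≡) ,
      cong suc (trans (Fin.toℕ-fromℕ (2 + r)) (cong suc (sym v≡)))))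
    complete : ∀ {y} → Edge (Car r) v y → ∃[ x ] fromℕ (2 + r) ≡ y
    complete (inj₁ (v≡1 , _ , _)) = contradiction (trans (sym v≡) (ℕ.suc-injective v≡1)) λ ()
    complete (inj₂ (inj₁ (_ , _ , eq))) = zero ,
      Fin.toℕ-injective (trans (Fin.toℕ-fromℕ (2 + r)) (sym (trans (ℕ.suc-injective eq) (cong suc v≡))))
    complete (inj₂ (inj₂ (_ , v<n , _))) =
      contradiction (subst (λ u → 2 + u ≤ 2 + r) v≡ v<n) (ℕ.<-irrefl refl)

  private
    tail-sum : ∀ {m} (g : Fin (suc m) → ℤ) → (∀ c → g (inject₁ c) ≡ 1ℤ) →
               ∀ c → partialSum g (inject₁ c) ≡ + suc (toℕ c)
    tail-sum g ones zero    = ones zero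
    tail-sum g ones (suc c) = cong₂ ℤ._+_ (ones zero) (tail-sum (g ∘ suc) (ones ∘ suc) c)

    tail-sum-last : ∀ {m} (g : Fin (suc m) → ℤ) → (∀ c → g (inject₁ c) ≡ 1ℤ) →
                    g (fromℕ m) ≡ 0ℤ → partialSum g (fromℕ m) ≡ + m
    tail-sum-last {zero}  g ones end = end
    tail-sum-last {suc m} g ones end =
      cong₂ ℤ._+_ (ones zero) (tail-sum-last (g ∘ suc) (ones ∘ suc) end)

    middle : ∀ c → carShift r (suc (inject₁ c)) ≡ 1ℤ
    middle c = cong (λ u → + u ℤ.- 1ℤ) (outDegree-middle c)

    source : carShift r zero ≡ + r
    source = cong (λ u → + u ℤ.- 1ℤ) outDegree-source

  partialSum-carShift : (k : Fin (suc r)) → partialSum (carShift r) (inject₁ k) ≡ + (r + toℕ k)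
  partialSum-carShift zero    = trans source (cong +_ (sym (ℕ.+-identityʳ r)))
  partialSum-carShift (suc k) =
    trans (cong₂ ℤ._+_ source (tail-sum (carShift r ∘ suc) middle k)) (sym (ℤ.pos-+ r _))

  partialSum-carShift-last : partialSum (carShift r) (fromℕ (suc r)) ≡ + (r + r)
  partialSum-carShift-last = trans
    (cong₂ ℤ._+_ source (tail-sum-last (carShift r ∘ suc) middle
      (cong (λ u → + u ℤ.- 1ℤ) outDegree-last)))
    (sym (ℤ.pos-+ r r))

  sum-carShift : ∑.sum (carShift r) ≡ + (r + r)
  sum-carShift = trans (sum≡partialSum (carShift r)) partialSum-carShift-last

-- Lines of the restricted caracol graph

-- The third family of `CarEdge` ends at the deleted sink and disappears. As an inductive family the
-- remaining edges reveal their endpoints by matching.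
data RestrictedEdge {r} : Fin (2 + r) → Fin (2 + r) → Set where
  jump : (c : Fin (suc r)) → RestrictedEdge zero (suc c)
  step : (k : Fin r) → RestrictedEdge (suc (inject₁ k)) (suc (suc k))

edge-view : ∀ r {p q} → Edge (restrict (Car r)) p q → RestrictedEdge p q
edge-view r {p} {zero}  (inj₁ (_ , s≤s () , _))
edge-view r {zero} {suc q} (inj₁ _) = jump q
edge-view r {suc p} {q} (inj₁ (() , _))
edge-view r {zero} (inj₂ (inj₁ (s≤s () , _)))
edge-view r {suc p} {zero} (inj₂ (inj₁ (_ , _ , ())))
edge-view r {suc p} {suc zero} (inj₂ (inj₁ (_ , _ , ())))
edge-view r {suc p} {suc (suc q)} (inj₂ (inj₁ (_ , _ , eq))) with p≡q
  where
  p≡q : p ≡ inject₁ q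
  p≡q = Fin.toℕ-injective (trans (sym (Fin.toℕ-inject₁ p))
    (ℕ.suc-injective (ℕ.suc-injective (ℕ.suc-injective (sym eq)))))
... | refl = step q
edge-view r {q = q} (inj₂ (inj₂ (_ , _ , eq))) =
  contradiction (trans (sym (Fin.toℕ-inject₁ q)) (ℕ.suc-injective eq)) (ℕ.<⇒≢ (Fin.toℕ<n q))

edge-unview : ∀ r {p q} → RestrictedEdge p q → Edge (restrict (Car r)) p q
edge-unview r (jump c) = inj₁ (refl , s≤s (s≤s z≤n) ,
  s≤s (s≤s (subst (_≤ r) (sym (Fin.toℕ-inject₁ c)) (Fin.toℕ≤pred[n] c))))
edge-unview r (step k) = inj₂ (inj₁ (s≤s (s≤s z≤n) ,
  s≤s (s≤s (subst (_≤ r) (sym k≡) (ℕ.<⇒≤ (Fin.toℕ<n k)))) ,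
  cong (λ u → suc (suc (suc u))) (trans (Fin.toℕ-inject₁ k) (sym k≡))))
  where
  k≡ : toℕ (inject₁ (inject₁ k)) ≡ toℕ k
  k≡ = trans (Fin.toℕ-inject₁ _) (Fin.toℕ-inject₁ k)

module Lines (r : ℕ) {L : ℕ} (src tgt : Fin L → Fin (2 + r))
  (isEdge : ∀ ℓ → Edge (restrict (Car r)) (src ℓ) (tgt ℓ)) where

  Spans : Fin L → Fin (suc r) → Set
  Spans ℓ k = src ℓ Fin.≤ k × k Fin.< tgt ℓ

  spans? : ∀ k → Decidable (λ ℓ → Spans ℓ k)
  spans? k ℓ = (src ℓ Fin.≤? k) ×-dec (k Fin.<? tgt ℓ)

  joins? : ∀ p q → Decidable (λ ℓ → src ℓ ≡ p × tgt ℓ ≡ q)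
  joins? p q ℓ = (src ℓ Fin.≟ p) ×-dec (tgt ℓ Fin.≟ q)

  jumpsOver? : ∀ k → Decidable (λ ℓ → src ℓ ≡ zero × k < toℕ (tgt ℓ))
  jumpsOver? k ℓ = (src ℓ Fin.≟ zero) ×-dec (k ℕ.<? toℕ (tgt ℓ))

  mult : Fin (2 + r) → Fin (2 + r) → ℕ
  mult p q = count (joins? p q)

  mult-nonedge : ∀ {p q} → ¬ RestrictedEdge p q → mult p q ≡ 0
  mult-nonedge ¬edge = count-none (joins? _ _) λ { ℓ (refl , refl) → ¬edge (edge-view r (isEdge ℓ)) }

  spans-zero : count (spans? zero) ≡ count (jumpsOver? 0)
  spans-zero = count-cong (spans? zero) (jumpsOver? 0)
    (λ (src≤0 , 0<tgt) → Fin.toℕ-injective (ℕ.n≤0⇒n≡0 src≤0) , 0<tgt)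
    (λ (src≡0 , 0<tgt) → ℕ.≤-reflexive (cong toℕ src≡0) , 0<tgt)

  -- A step occupies a single column, so besides the jumps passing over it a column contains only
  -- its own step.
  spans-suc : ∀ k → count (spans? (suc k)) ≡
              count (jumpsOver? (suc (toℕ k))) + mult (suc (inject₁ k)) (suc (suc k))
  spans-suc k = count-⊎ (spans? (suc k)) (jumpsOver? (suc (toℕ k))) (joins? _ _) split
    (λ (src≡0 , k<tgt) → subst (λ p → toℕ p ≤ suc (toℕ k)) (sym src≡0) z≤n , k<tgt)
    (λ (src≡k , tgt≡) →
      subst (λ p → toℕ p ≤ suc (toℕ k)) (sym src≡k) (s≤s (ℕ.≤-reflexive (Fin.toℕ-inject₁ k))) ,
      subst (λ q → suc (toℕ k) < toℕ q) (sym tgt≡) ℕ.≤-refl)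
    (λ (src≡0 , _) (src≡k , _) → contradiction (trans (sym src≡0) src≡k) λ ())
    where
    split : ∀ {ℓ} → Spans ℓ (suc k) →
            (src ℓ ≡ zero × suc (toℕ k) < toℕ (tgt ℓ)) ⊎
            (src ℓ ≡ suc (inject₁ k) × tgt ℓ ≡ suc (suc k))
    split {ℓ} (src≤k , k<tgt) with src ℓ | tgt ℓ | edge-view r (isEdge ℓ)
    ... | _ | _ | jump c = inj₁ (refl , k<tgt)
    ... | _ | _ | step m with Fin.toℕ-injective {i = m} {k} (ℕ.≤-antisym
            (ℕ.≤-trans (ℕ.≤-reflexive (sym (Fin.toℕ-inject₁ m))) (ℕ.s≤s⁻¹ src≤k))
            (ℕ.s≤s⁻¹ (ℕ.s≤s⁻¹ k<tgt)))
    ...   | refl = inj₂ (refl , refl)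

  jumpsOver-step : ∀ c → count (jumpsOver? (toℕ c)) ≡
                   mult zero (suc c) + count (jumpsOver? (suc (toℕ c)))
  jumpsOver-step c = count-⊎ (jumpsOver? (toℕ c)) (joins? _ _) (jumpsOver? (suc (toℕ c)))
    (λ {ℓ} (src≡0 , c<tgt) → [ (λ c<<tgt → inj₂ (src≡0 , c<<tgt)) ,
        (λ eq → inj₁ (src≡0 , Fin.toℕ-injective (sym eq))) ]′ (ℕ.m≤n⇒m<n∨m≡n c<tgt))
    (λ (src≡0 , tgt≡) → src≡0 , subst (λ q → toℕ c < toℕ q) (sym tgt≡) ℕ.≤-refl)
    (λ (src≡0 , c<tgt) → src≡0 , ℕ.<⇒≤ c<tgt)
    (λ (_ , tgt≡) (_ , c<tgt) → ℕ.<⇒≢ c<tgt (sym (cong toℕ tgt≡)))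

  module _ (y : Vec ℕ (suc r)) (y-mult : ∀ c → mult zero (suc c) ≡ lookup y c) where

    jumpsOver-prefix : ∀ k → k ≤ suc r → count (jumpsOver? 0) ≡ prefix y k + count (jumpsOver? k)
    jumpsOver-prefix zero    _   = cong (_+ count (jumpsOver? 0)) (sym (prefix-zero y))
    jumpsOver-prefix (suc k) k<N = begin
      count (jumpsOver? 0)
        ≡⟨ jumpsOver-prefix k (ℕ.<⇒≤ k<N) ⟩
      prefix y k + count (jumpsOver? k)
        ≡⟨ cong (λ m → prefix y m + count (jumpsOver? m)) c≡k ⟨
      prefix y (toℕ c) + count (jumpsOver? (toℕ c))
        ≡⟨ cong (λ m → prefix y (toℕ c) + m) (jumpsOver-step c) ⟩
      prefix y (toℕ c) + (mult zero (suc c) + J)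
        ≡⟨ ℕ.+-assoc (prefix y (toℕ c)) _ J ⟨
      prefix y (toℕ c) + mult zero (suc c) + J
        ≡⟨ cong (λ m → prefix y (toℕ c) + m + J) (y-mult c) ⟩
      prefix y (toℕ c) + lookup y c + J
        ≡⟨ cong (_+ J) (prefix-suc y c) ⟨
      prefix y (suc (toℕ c)) + J
        ≡⟨ cong (λ m → prefix y (suc m) + count (jumpsOver? (suc m))) c≡k ⟩
      prefix y (suc k) + count (jumpsOver? (suc k)) ∎
      where
      open ≡-Reasoning
      c = Fin.fromℕ< k<N
      c≡k = Fin.toℕ-fromℕ< k<N
      J = count (jumpsOver? (suc (toℕ c)))

    jumps-total : count (jumpsOver? 0) ≡ Vec.sum y
    jumps-total = begin
      count (jumpsOver? 0)                                  ≡⟨ jumpsOver-prefix (suc r) ℕ.≤-refl ⟩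
      prefix y (suc r) + count (jumpsOver? (suc r))         ≡⟨ cong₂ _+_ (prefix-all y) none ⟩
      Vec.sum y + 0                                         ≡⟨ ℕ.+-identityʳ _ ⟩
      Vec.sum y                                             ∎
      where
      open ≡-Reasoning
      none : count (jumpsOver? (suc r)) ≡ 0
      none = count-none (jumpsOver? (suc r)) λ ℓ (_ , N<tgt) → ℕ.<⇒≱ N<tgt (Fin.toℕ≤pred[n] (tgt ℓ))

    first-column : count (spans? zero) ≡ Vec.sum y
    first-column = trans spans-zero jumps-total

    -- The jumps passing over the column are all jumps except those that landed earlier, `sum y`
    -- minus a prefix; the additive form avoids truncated subtraction.
    later-column : ∀ k → count (spans? (suc k)) + prefix y (suc (toℕ k)) ≡
                   Vec.sum y + mult (suc (inject₁ k)) (suc (suc k))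
    later-column k = begin
      count (spans? (suc k)) + Y ≡⟨ cong (_+ Y) (spans-suc k) ⟩
      J + μ + Y                  ≡⟨ ℕ.+-comm (J + μ) Y ⟩
      Y + (J + μ)                ≡⟨ ℕ.+-assoc Y J μ ⟨
      Y + J + μ                  ≡⟨ cong (_+ μ) (jumpsOver-prefix _ (s≤s (ℕ.<⇒≤ (Fin.toℕ<n k)))) ⟨
      count (jumpsOver? 0) + μ   ≡⟨ cong (_+ μ) jumps-total ⟩
      Vec.sum y + μ              ∎
      where
      open ≡-Reasoning
      Y = prefix y (suc (toℕ k))
      J = count (jumpsOver? (suc (toℕ k)))
      μ = mult (suc (inject₁ k)) (suc (suc k))

-- Line systems with prescribed multiplicities

multiset : ∀ {m} (M : Fin m → ℕ) →
  ∃[ L ] Σ[ g ∈ (Fin L → Fin m) ] (∀ x → count (λ ℓ → g ℓ Fin.≟ x) ≡ M x)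
multiset {zero}  M = 0 , (λ ()) , λ ()
multiset {suc m} M with multiset (M ∘ suc)
... | L , g , g-count = M zero + L , h , h-count
  where
  h : Fin (M zero + L) → Fin (suc m)
  h ℓ = [ (λ _ → zero) , suc ∘ g ]′ (Fin.splitAt (M zero) ℓ)
  h-left : ∀ x → h (x ↑ˡ L) ≡ zero
  h-left x = cong [ _ , _ ]′ (Fin.splitAt-↑ˡ (M zero) x L)
  h-right : ∀ x → h (M zero ↑ʳ x) ≡ suc (g x)
  h-right x = cong [ _ , _ ]′ (Fin.splitAt-↑ʳ (M zero) L x)
  h-count : ∀ x → count (λ ℓ → h ℓ Fin.≟ x) ≡ M x
  h-count zero = sym (count-image (λ ℓ → h ℓ Fin.≟ zero) (Fin.↑ˡ-injective L _ _) h-left complete)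
    where
    complete : ∀ {ℓ} → h ℓ ≡ zero → ∃[ x ] x ↑ˡ L ≡ ℓ
    complete {ℓ} _ with Fin.splitAt (M zero) ℓ in eq
    ... | inj₁ x = x , Fin.splitAt⁻¹-↑ˡ eq
  h-count (suc x) = trans (sym (count-image (λ ℓ → h ℓ Fin.≟ suc x) {g = λ z → M zero ↑ʳ nth here? z}
      (λ eq → nth-injective here? (Fin.↑ʳ-injective (M zero) _ _ eq))
      (λ z → trans (h-right (nth here? z)) (cong suc (nth-sound here? z)))
      complete))
    (g-count x)
    where
    here? : Decidable (λ ℓ → g ℓ ≡ x)
    here? ℓ = g ℓ Fin.≟ x
    complete : ∀ {ℓ} → h ℓ ≡ suc x → ∃[ z ] M zero ↑ʳ nth here? z ≡ ℓ
    complete {ℓ} hℓ≡ with Fin.splitAt (M zero) ℓ in eq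
    ... | inj₂ z = let w , nth≡z = nth-complete here? (Fin.suc-injective hℓ≡) in
      w , trans (cong (M zero ↑ʳ_) nth≡z) (Fin.splitAt⁻¹-↑ʳ eq)

-- A pair of endpoints is coded as one element of `Fin (m * m)`, which reduces the claim to
-- `multiset`.
lines-with-multiplicities : ∀ {m} (M : Fin m → Fin m → ℕ) →
  ∃[ L ] Σ[ src ∈ (Fin L → Fin m) ] Σ[ tgt ∈ (Fin L → Fin m) ]
  (∀ p q → count (λ ℓ → (src ℓ Fin.≟ p) ×-dec (tgt ℓ Fin.≟ q)) ≡ M p q)
lines-with-multiplicities {m} M with multiset (uncurry M ∘ Fin.remQuot {m} m)
... | L , g , g-count = L , src , tgt , λ p q → trans
  (count-cong _ (λ ℓ → g ℓ Fin.≟ Fin.combine p q)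
    (λ { {ℓ} (refl , refl) → sym (Fin.combine-remQuot {m} m (g ℓ)) })
    (λ { {ℓ} gℓ≡ → let eq = trans (cong (Fin.remQuot {m} m) gℓ≡) (Fin.remQuot-combine p q)
                   in cong proj₁ eq , cong proj₂ eq }))
  (trans (g-count (Fin.combine p q)) (cong (uncurry M) (Fin.remQuot-combine p q)))
  where
  src tgt : Fin L → Fin m
  src ℓ = proj₁ (Fin.remQuot {m} m (g ℓ))
  tgt ℓ = proj₂ (Fin.remQuot {m} m (g ℓ))

-- Gravity diagrams as line systems

module _ {r : ℕ} {v : Fin (2 + r) → ℤ} where

  module DiagramLines (D : LineDotDiagram (restrict (Car r)) v) where
    open LineDotDiagram D public using (d; source; target; isEdge)
    open LineDotDiagram D using (lineOf; oneInside; noneOutside; expand)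
    open Lines r source target isEdge public using (spans?; first-column; later-column; mult-nonedge)

    -- By `oneInside` and `noneOutside`, `lineOf k` is a bijection from the dots of column `k` to
    -- the lines spanning it.
    d≡spans : ∀ k → d k ≡ count (spans? k)
    d≡spans k = count-image (spans? k) {g = lineOf k} lineOf-injective (noneOutside k)
      (λ {ℓ} spans → let x , eq , _ = oneInside ℓ k spans in x , eq)
      where
      lineOf-injective : ∀ {x y} → lineOf k x ≡ lineOf k y → x ≡ y
      lineOf-injective {x} {y} eq with oneInside (lineOf k x) k (noneOutside k x)
      ... | _ , _ , unique = trans (sym (unique refl)) (unique (sym eq))

    d≡partialSum : ∀ k → + d k ≡ partialSum v (inject₁ k)
    d≡partialSum k = trans (sym (partialSum-expansion d k))
      (partialSum-cong (λ j → sym (expand j)) (inject₁ k))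

  module _ {L : ℕ} (src tgt : Fin L → Fin (2 + r))
           (isEdge : ∀ ℓ → Edge (restrict (Car r)) (src ℓ) (tgt ℓ)) where
    open Lines r src tgt isEdge using (spans?)

    -- The dots of a column are taken to be the lines that span it, so the partition conditions hold
    -- by construction and only the netflow has to be checked.
    diagram-of-lines : (∀ k → + count (spans? k) ≡ partialSum v (inject₁ k)) →
                       partialSum v (fromℕ (suc r)) ≡ 0ℤ → LineDotDiagram (restrict (Car r)) v
    diagram-of-lines columns total = record
      { d           = λ k → count (spans? k)
      ; expand      = expansion-unique (λ k → count (spans? k)) columns total
      ; #lines      = L
      ; source      = src
      ; target      = tgt
      ; isEdge      = isEdge
      ; lineOf      = λ k → nth (spans? k)
      ; oneInside   = λ ℓ k spans → let x , eq = nth-complete (spans? k) spans in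
                        x , eq , λ eq′ → nth-injective (spans? k) (trans eq (sym eq′))
      ; noneOutside = λ k → nth-sound (spans? k)
      }

-- Unified diagrams as parking configurations

lookup-injective : ∀ {A : Set} {n} {u v : Vec A n} → (∀ j → lookup u j ≡ lookup v j) → u ≡ v
lookup-injective {u = u} {v} eq =
  trans (sym (Vec.tabulate∘lookup u)) (trans (Vec.tabulate-cong eq) (Vec.tabulate∘lookup v))

module _ {r i a : ℕ} (i+a≡r : i + a ≡ r) where

  pathOf : Vec (Fin (suc r)) i → Vec ℕ (2 + r)
  pathOf f = (r + a) ∷ tally f

  r+a+i≡r+r : r + a + i ≡ r + r
  r+a+i≡r+r = trans (ℕ.+-assoc r a i) (cong (λ m → r + m) (trans (ℕ.+-comm a i) i+a≡r))

  netflow : Vec ℕ (2 + r) → Fin (2 + r) → ℤ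
  netflow s j = + lookup s j ℤ.- carShift r j

  partialSum-netflow : ∀ f k → partialSum (netflow (pathOf f)) (inject₁ k) ≡
                       + (r + a + prefix (tally f) (toℕ k)) ℤ.- + (r + toℕ k)
  partialSum-netflow f k = trans
    (partialSum-minus (λ j → + lookup (pathOf f) j) (carShift r) (inject₁ k))
    (cong₂ ℤ._-_
      (trans (partialSum-lookup (pathOf f) (inject₁ k))
             (cong (λ m → + (r + a + prefix (tally f) m)) (Fin.toℕ-inject₁ k)))
      (partialSum-carShift r k))

  partialSum-path-last : ∀ f → partialSum (λ j → + lookup (pathOf f) j) (fromℕ (suc r)) ≡ + (r + r)
  partialSum-path-last f = trans (partialSum-lookup (pathOf f) (fromℕ (suc r))) (cong +_ (begin
    r + a + prefix (tally f) (toℕ (fromℕ (suc r)))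
      ≡⟨ cong (λ m → r + a + prefix (tally f) m) (Fin.toℕ-fromℕ (suc r)) ⟩
    r + a + prefix (tally f) (suc r)
      ≡⟨ cong (λ m → r + a + m) (trans (prefix-all (tally f)) (sum-tally f)) ⟩
    r + a + i
      ≡⟨ r+a+i≡r+r ⟩
    r + r ∎))
    where open ≡-Reasoning

  partialSum-netflow-last : ∀ f → partialSum (netflow (pathOf f)) (fromℕ (suc r)) ≡ 0ℤ
  partialSum-netflow-last f =
    trans (partialSum-minus (λ j → + lookup (pathOf f) j) (carShift r) (fromℕ (suc r)))
      (trans (cong₂ ℤ._-_ (partialSum-path-last f) (partialSum-carShift-last r))
             (ℤ.+-inverseʳ (+ (r + r))))

  -- Only the labelled and the unlabelled cars are recorded. The path, the total of `y` and the step
  -- multiplicities are derived from them below.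
  record Represents (U : UnifiedDiagram r i) (f : Vec (Fin (suc r)) i) (y : Vec ℕ (suc r)) : Set where
    field
      column : ∀ c k → lookup f (Inverse.to (σ U) (c , k)) ≡ c
      jumps  : ∀ c → multiplicity (diagram U) zero (suc c) ≡ lookup y c

    label-in-column : ∀ {x c} → lookup f x ≡ c → ∃[ k ] Inverse.to (σ U) (c , k) ≡ x
    label-in-column {x} refl with Inverse.from (σ U) x | Inverse.strictlyInverseˡ (σ U) x
    ... | c , k | eq with trans (sym (column c k)) (cong (lookup f) eq)
    ...   | refl = k , eq

    column-tally : ∀ c → lookup (s U) (suc c) ≡ lookup (tally f) c
    column-tally c = trans
      (count-image (λ x → lookup f x Fin.≟ c) {g = λ k → Inverse.to (σ U) (c , k)}
        (λ eq → pair-injective (to-injective (σ U) eq)) (column c) label-in-column)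
      (sym (lookup-tally f c))
      where
      pair-injective : ∀ {k k′ : Fin (lookup (s U) (suc c))} →
                       _≡_ {A = NorthStep (s U)} (c , k) (c , k′) → k ≡ k′
      pair-injective refl = refl

    head-path : head (s U) ≡ r + a
    head-path = ℕ.+-cancelʳ-≡ i (head (s U)) (r + a) (trans
      (≡-⇒+≡ (trans (level U) (cong (ℤ._- + i) (sum-carShift r)))) (sym r+a+i≡r+r))

    path≡ : s U ≡ pathOf f
    path≡ = lookup-injective λ { zero → trans (go (s U)) head-path ; (suc c) → column-tally c }
      where
      go : ∀ {n} (v : Vec ℕ (suc n)) → lookup v zero ≡ head v
      go (_ ∷ _) = refl

    open DiagramLines (diagram U) using (d; spans?; d≡spans; d≡partialSum; first-column; later-column)

    spans-tally : ∀ k → count (spans? k) + toℕ k ≡ a + prefix (tally f) (toℕ k)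
    spans-tally k = ℕ.+-cancelˡ-≡ r _ _ (begin
      r + (count (spans? k) + toℕ k)       ≡⟨ cong (λ m → r + (m + toℕ k)) (d≡spans k) ⟨
      r + (d k + toℕ k)                    ≡⟨ x∙yz≈y∙xz r (d k) (toℕ k) ⟩
      d k + (r + toℕ k)                    ≡⟨ ≡-⇒+≡ (trans (d≡partialSum k) flow) ⟩
      r + a + prefix (tally f) (toℕ k)     ≡⟨ ℕ.+-assoc r a _ ⟩
      r + (a + prefix (tally f) (toℕ k))   ∎)
      where
      open ≡-Reasoning
      flow : partialSum (netflow (s U)) (inject₁ k) ≡
             + (r + a + prefix (tally f) (toℕ k)) ℤ.- + (r + toℕ k)
      flow = trans (cong (λ t → partialSum (netflow t) (inject₁ k)) path≡) (partialSum-netflow f k)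

    sum-jumps : Vec.sum y ≡ a
    sum-jumps = begin
      Vec.sum y                   ≡⟨ first-column y jumps ⟨
      count (spans? zero)         ≡⟨ ℕ.+-identityʳ _ ⟨
      count (spans? zero) + 0     ≡⟨ spans-tally zero ⟩
      a + prefix (tally f) 0      ≡⟨ cong (λ m → a + m) (prefix-zero (tally f)) ⟩
      a + 0                       ≡⟨ ℕ.+-identityʳ a ⟩
      a                           ∎
      where open ≡-Reasoning

    -- Two counts of the lines in column `K` are compared: the netflow gives `a + F - K`, and the
    -- jumps together with the step give `a - Y + μ`.
    steps : ∀ k → multiplicity (diagram U) (suc (inject₁ k)) (suc (suc k)) + suc (toℕ k) ≡
            prefix (tally f ⊕ y) (suc (toℕ k))
    steps k = ℕ.+-cancelˡ-≡ a _ _ (begin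
      a + (μ + K)           ≡⟨ ℕ.+-assoc a μ K ⟨
      a + μ + K             ≡⟨ cong (λ z → z + μ + K) sum-jumps ⟨
      Vec.sum y + μ + K     ≡⟨ cong (λ z → z + K) (later-column y jumps k) ⟨
      S + Y + K             ≡⟨ xy∙z≈xz∙y S Y K ⟩
      S + K + Y             ≡⟨ cong (λ z → z + Y) (spans-tally (suc k)) ⟩
      a + F + Y             ≡⟨ ℕ.+-assoc a F Y ⟩
      a + (F + Y)           ≡⟨ cong (λ z → a + z) (prefix-⊕ (tally f) y K) ⟨
      a + prefix (tally f ⊕ y) K ∎)
      where
      open ≡-Reasoning
      K = suc (toℕ k)
      μ = multiplicity (diagram U) (suc (inject₁ k)) (suc (suc k))
      S = count (spans? (suc k))
      F = prefix (tally f) K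
      Y = prefix y K

    parks : ∀ {k} → k ≤ r → k ≤ prefix (tally f ⊕ y) k
    parks z≤n           = z≤n
    parks (s≤s {k} k<r) = subst (λ m → suc m ≤ prefix (tally f ⊕ y) (suc m))
      (Fin.toℕ-fromℕ< (s≤s k<r))
      (subst (suc (toℕ c) ≤_) (steps c) (ℕ.m≤n+m _ _))
      where c = Fin.fromℕ< (s≤s k<r)

  open Represents

  representative : (U : UnifiedDiagram r i) → ∃[ f ] ∃[ y ] Represents U f y
  representative U = tabulate columnOf , tabulate jumpsTo , record
    { column = λ c k → trans (Vec.lookup∘tabulate columnOf (Inverse.to (σ U) (c , k)))
                             (cong proj₁ (Inverse.strictlyInverseʳ (σ U) (c , k)))
    ; jumps  = λ c → sym (Vec.lookup∘tabulate jumpsTo c)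
    }
    where
    columnOf : Fin i → Fin (suc r)
    columnOf = proj₁ ∘ Inverse.from (σ U)
    jumpsTo : Fin (suc r) → ℕ
    jumpsTo c = multiplicity (diagram U) zero (suc c)

  represents-unique : ∀ {U U′ f y} → Represents U f y → Represents U′ f y → U ≈ᵁ U′
  represents-unique {U} {U′} {f} R R′ = record
    { path   = trans (path≡ R) (sym (path≡ R′))
    ; labels = λ c → mono-unique (increasing U c) (increasing U′ c)
        (λ k → label-in-column R′ (column R c k)) (λ k → label-in-column R (column R′ c k))
    ; lines  = multiplicities
    }
    where
    multiplicities : diagram U ≈ᴳ diagram U′
    multiplicities p q with edge? (restrict (Car r)) p q
    ... | no ¬edge = trans (DiagramLines.mult-nonedge (diagram U) (¬edge ∘ edge-unview r))
                      (sym (DiagramLines.mult-nonedge (diagram U′) (¬edge ∘ edge-unview r)))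
    ... | yes edge with edge-view r edge
    ...   | jump c = trans (jumps R c) (sym (jumps R′ c))
    ...   | step k = ℕ.+-cancelʳ-≡ (suc (toℕ k)) _ _ (trans (steps R k) (sym (steps R′ k)))

  represents-functional : ∀ {U U′ f f′ y y′} → U ≈ᵁ U′ → Represents U f y → Represents U′ f′ y′ →
                          f ≡ f′ × y ≡ y′
  represents-functional {U} {U′} {f} {f′} U≈U′ R R′ =
    lookup-injective same-column ,
    lookup-injective (λ c → trans (sym (jumps R c)) (trans (_≈ᵁ_.lines U≈U′ zero (suc c)) (jumps R′ c)))
    where
    same-column : ∀ x → lookup f x ≡ lookup f′ x
    same-column x = begin
      lookup f x                                ≡⟨ column R′ c pos′ ⟨
      lookup f′ (Inverse.to (σ U′) (c , pos′))  ≡⟨ cong (lookup f′) same-label ⟨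
      lookup f′ (Inverse.to (σ U) (c , pos))    ≡⟨ cong (lookup f′) (proj₂ found) ⟩
      lookup f′ x                               ∎
      where
      open ≡-Reasoning
      c = lookup f x
      found = label-in-column R {x} refl
      pos = proj₁ found
      eq = cong (λ v → lookup v (suc c)) (_≈ᵁ_.path U≈U′)
      pos′ = Fin.cast eq pos
      same-label = _≈ᵁ_.labels U≈U′ c pos pos′ (sym (Fin.toℕ-cast eq pos))

  module Build (f : Vec (Fin (suc r)) i) (y : Vec ℕ (suc r)) (sum-y : Vec.sum y ≡ a)
               (park : ∀ {k} → k ≤ r → k ≤ prefix (tally f ⊕ y) k) where

    in-column? : ∀ c → Decidable (λ x → lookup f x ≡ c)
    in-column? c x = lookup f x Fin.≟ c

    label : NorthStep (pathOf f) → Fin i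
    label (c , k) = nth (in-column? c) (Fin.cast (lookup-tally f c) k)

    label-column : ∀ c k → lookup f (label (c , k)) ≡ c
    label-column c k = nth-sound (in-column? c) _

    label-injective : ∀ {u v} → label u ≡ label v → u ≡ v
    label-injective {c , k} {c′ , k′} eq
      with trans (sym (label-column c k)) (trans (cong (lookup f) eq) (label-column c′ k′))
    ... | refl = cong (c ,_) (Fin.toℕ-injective (begin
      toℕ k                                  ≡⟨ Fin.toℕ-cast (lookup-tally f c) k ⟨
      toℕ (Fin.cast (lookup-tally f c) k)    ≡⟨ cong toℕ (nth-injective (in-column? c) eq) ⟩
      toℕ (Fin.cast (lookup-tally f c) k′)   ≡⟨ Fin.toℕ-cast (lookup-tally f c) k′ ⟩
      toℕ k′                                 ∎))
      where open ≡-Reasoning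

    label-surjective : ∀ x → ∃[ u ] label u ≡ x
    label-surjective x = (c , Fin.cast (sym (lookup-tally f c)) z) ,
      trans (cong (nth (in-column? c))
                  (Fin.cast-involutive (lookup-tally f c) (sym (lookup-tally f c)) z)) nth≡x
      where
      c = lookup f x
      found = nth-complete (in-column? c) {x} refl
      z = proj₁ found
      nth≡x = proj₂ found

    labelling : NorthStep (pathOf f) ↔ Fin i
    labelling = ⤖⇒↔ (mk⤖ (label-injective , strictlySurjective⇒surjective label-surjective))

    weight : Fin (2 + r) → Fin (2 + r) → ℕ
    weight zero    zero    = 0
    weight zero    (suc c) = lookup y c
    -- On a step `park` keeps this subtraction from truncating; off the edges `M` masks the value.
    weight (suc k) _       = prefix (tally f ⊕ y) (suc (toℕ k)) ∸ suc (toℕ k)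

    M : Fin (2 + r) → Fin (2 + r) → ℕ
    M p q = if does (edge? (restrict (Car r)) p q) then weight p q else 0

    M-edge : ∀ {p q} → RestrictedEdge p q → M p q ≡ weight p q
    M-edge {p} {q} edge = cong (if_then weight p q else 0)
      (dec-true (edge? (restrict (Car r)) p q) (edge-unview r edge))

    M-nonedge : ∀ {p q} → ¬ Edge (restrict (Car r)) p q → M p q ≡ 0
    M-nonedge {p} {q} ¬edge = cong (if_then weight p q else 0)
      (dec-false (edge? (restrict (Car r)) p q) ¬edge)

    private
      system = lines-with-multiplicities M
      L = proj₁ system
      src tgt : Fin L → Fin (2 + r)
      src = proj₁ (proj₂ system)
      tgt = proj₁ (proj₂ (proj₂ system))
      mult≡M : ∀ p q → count (λ ℓ → (src ℓ Fin.≟ p) ×-dec (tgt ℓ Fin.≟ q)) ≡ M p q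
      mult≡M = proj₂ (proj₂ (proj₂ system))

      joins? : ∀ p q → Decidable (λ ℓ → src ℓ ≡ p × tgt ℓ ≡ q)
      joins? p q ℓ = (src ℓ Fin.≟ p) ×-dec (tgt ℓ Fin.≟ q)

      isEdge : ∀ ℓ → Edge (restrict (Car r)) (src ℓ) (tgt ℓ)
      isEdge ℓ with edge? (restrict (Car r)) (src ℓ) (tgt ℓ)
      ... | yes edge = edge
      -- The line itself would be a member of an empty class, since `M` vanishes off the edges.
      ... | no ¬edge = contradiction
        (subst Fin (trans (mult≡M (src ℓ) (tgt ℓ)) (M-nonedge ¬edge))
          (proj₁ (nth-complete (joins? (src ℓ) (tgt ℓ)) {ℓ} (refl , refl))))
        λ ()

      open Lines r src tgt isEdge using (spans?; first-column; later-column)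

      jumps≡y : ∀ c → count (λ ℓ → (src ℓ Fin.≟ zero) ×-dec (tgt ℓ Fin.≟ suc c)) ≡ lookup y c
      jumps≡y c = trans (mult≡M zero (suc c)) (M-edge (jump c))

      -- The balance of `steps` read backwards: the weight `H ∸ K` of a step is exactly what fills
      -- the column up to the netflow.
      spans+ : ∀ k → count (spans? k) + toℕ k ≡ a + prefix (tally f) (toℕ k)
      spans+ zero    = trans (ℕ.+-identityʳ _) (trans (first-column y jumps≡y) (trans sum-y
        (sym (trans (cong (λ z → a + z) (prefix-zero (tally f))) (ℕ.+-identityʳ a)))))
      spans+ (suc k) = ℕ.+-cancelʳ-≡ Y _ _ (begin
        S + K + Y               ≡⟨ xy∙z≈xz∙y S K Y ⟩
        S + Y + K               ≡⟨ cong (λ z → z + K) (later-column y jumps≡y k) ⟩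
        Vec.sum y + μ + K       ≡⟨ ℕ.+-assoc (Vec.sum y) μ K ⟩
        Vec.sum y + (μ + K)     ≡⟨ cong₂ (λ b z → b + (z + K)) sum-y μ≡ ⟩
        a + (H ∸ K + K)         ≡⟨ cong (λ z → a + z) (ℕ.m∸n+n≡m (park (Fin.toℕ<n k))) ⟩
        a + H                   ≡⟨ cong (λ z → a + z) (prefix-⊕ (tally f) y K) ⟩
        a + (prefix (tally f) K + Y) ≡⟨ ℕ.+-assoc a _ Y ⟨
        a + prefix (tally f) K + Y   ∎)
        where
        open ≡-Reasoning
        K = suc (toℕ k)
        μ = count (λ ℓ → (src ℓ Fin.≟ suc (inject₁ k)) ×-dec (tgt ℓ Fin.≟ suc (suc k)))
        S = count (spans? (suc k))
        Y = prefix y K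
        H = prefix (tally f ⊕ y) K
        μ≡ : μ ≡ H ∸ K
        μ≡ = trans (mult≡M _ _) (trans (M-edge (step k))
          (cong (λ z → prefix (tally f ⊕ y) (suc z) ∸ suc z) (Fin.toℕ-inject₁ k)))

      columns : ∀ k → + count (spans? k) ≡ partialSum (netflow (pathOf f)) (inject₁ k)
      columns k = trans (+≡⇒≡- (begin
        count (spans? k) + (r + toℕ k)       ≡⟨ x∙yz≈y∙xz (count (spans? k)) r (toℕ k) ⟩
        r + (count (spans? k) + toℕ k)       ≡⟨ cong (λ z → r + z) (spans+ k) ⟩
        r + (a + prefix (tally f) (toℕ k))   ≡⟨ ℕ.+-assoc r a _ ⟨
        r + a + prefix (tally f) (toℕ k)     ∎))
        (sym (partialSum-netflow f k))
        where open ≡-Reasoning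

      -- Dropping the number of lines from `spans+` leaves `k ≤ a + prefix (tally f) k`, which is
      -- the Dyck inequality after adding `r`. At the last position both sums are `r + r`.
      dominates : ∀ k → partialSum (carShift r) k ℤ.≤ partialSum (λ j → + lookup (pathOf f) j) k
      dominates k with view k
      ... | ‵fromℕ     = ℤ.≤-reflexive
        (trans (partialSum-carShift-last r) (sym (partialSum-path-last f)))
      ... | ‵inject₁ k = subst₂ ℤ._≤_ (sym (partialSum-carShift r k))
        (sym (partialSum-lookup (pathOf f) (inject₁ k)))
        (ℤ.+≤+ (subst (λ m → r + toℕ k ≤ r + a + prefix (tally f) m) (sym (Fin.toℕ-inject₁ k))
          (ℕ.≤-trans (ℕ.+-monoʳ-≤ r (subst (toℕ k ≤_) (spans+ k) (ℕ.m≤n+m _ _)))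
                     (ℕ.≤-reflexive (sym (ℕ.+-assoc r a _))))))

    abstract
      unified : UnifiedDiagram r i
      unified = record
        { s          = pathOf f
        ; isDyckPath = record
          { total    = trans (sum≡partialSum (λ j → + lookup (pathOf f) j))
                         (trans (partialSum-path-last f) (sym (sum-carShift r)))
          ; dominant = dominates
          }
        ; level      = trans (+≡⇒≡- r+a+i≡r+r) (cong (ℤ._- + i) (sym (sum-carShift r)))
        ; σ          = labelling
        ; increasing = λ c {k} {k′} k<k′ → nth-mono (in-column? c)
            (subst₂ _<_ (sym (Fin.toℕ-cast (lookup-tally f c) k))
                        (sym (Fin.toℕ-cast (lookup-tally f c) k′)) k<k′)
        ; diagram    = diagram-of-lines src tgt isEdge columns (partialSum-netflow-last f)
        }

      unified-represents : Represents unified f y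
      unified-represents = record { column = label-column ; jumps = jumps≡y }

  module _ {T : ℕ} (config : Fin T → Config (suc r) i a)
           (config-injective : Injective _≡_ _≡_ config)
           (config-sound : ∀ x → ParkingConfig (config x))
           (config-complete : ∀ ω → ParkingConfig ω → ∃[ x ] config x ≡ ω) where

    private
      module At (x : Fin T) =
        Build (proj₁ (config x)) (proj₁ (proj₂ (config x))) (proj₂ (proj₂ (config x))) (config-sound x)

      build : Fin T → UnifiedDiagram r i
      build = At.unified

      built : ∀ x → Represents (build x) (proj₁ (config x)) (proj₁ (proj₂ (config x)))
      built = At.unified-represents

      build-injective : ∀ {x x′} → build x ≈ᵁ build x′ → x ≡ x′
      build-injective {x} {x′} eq =
        let f≡ , y≡ = represents-functional eq (built x) (built x′)
        in config-injective (Config-≡ f≡ y≡)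

      build-surjective : ∀ U → ∃[ x ] (∀ {z} → z ≡ x → build z ≈ᵁ U)
      build-surjective U =
        let f , y , R = representative U
            x , eq = config-complete (f , y , sum-jumps R) (parks R)
        in x , λ { refl → represents-unique
             (subst (λ ω → Represents (build x) (proj₁ ω) (proj₁ (proj₂ ω))) eq (built x)) R }

    𝒰-cardinality : HasCardinality (𝒰 r i) T
    𝒰-cardinality = record
      { to        = build
      ; cong      = λ { {x} refl → represents-unique (built x) (built x) }
      ; bijective = build-injective , build-surjective
      }

-- The closed formula over the rationals

fraction-product : ∀ x y d z → x *ℕ suc d ≡ y *ℕ z → + x / 1 ≡ (+ y / suc d) * (+ z / 1)
fraction-product x y d z eq = ℚ.toℚᵘ-injective (begin
  ℚ.toℚᵘ (+ x / 1)                              ≈⟨ ℚ.toℚᵘ-fromℚᵘ (mkℚᵘ (+ x) 0) ⟩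
  mkℚᵘ (+ x) 0                                  ≈⟨ *≡* cross ⟩
  mkℚᵘ (+ y) d ℚᵘ.* mkℚᵘ (+ z) 0                ≈⟨ ℚᵘ.*-cong (ℚ.toℚᵘ-fromℚᵘ (mkℚᵘ (+ y) d))
                                                              (ℚ.toℚᵘ-fromℚᵘ (mkℚᵘ (+ z) 0)) ⟨
  ℚ.toℚᵘ (+ y / suc d) ℚᵘ.* ℚ.toℚᵘ (+ z / 1)    ≈⟨ ℚ.toℚᵘ-homo-* (+ y / suc d) (+ z / 1) ⟨
  ℚ.toℚᵘ ((+ y / suc d) * (+ z / 1))            ∎)
  where
  open import Relation.Binary.Reasoning.Setoid ℚᵘ.≃-setoid
  cross : + x ℤ.* + (suc d *ℕ 1) ≡ (+ y ℤ.* + z) ℤ.* + 1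
  cross = trans (sym (ℤ.pos-* x (suc d *ℕ 1)))
    (trans (cong +_ (trans (cong (x *ℕ_) (ℕ.*-identityʳ (suc d))) eq))
    (trans (ℤ.pos-* y z) (sym (ℤ.*-identityʳ _))))

-- For `i = 0` the power is a true fraction with denominator `r + 1`; for positive `i` one factor
-- `r + 1` cancels among the naturals.
quotient-formula : ∀ r i T c → T *ℕ suc r ≡ suc r ^ i *ℕ c →
                   + T / 1 ≡ (suc r ^ℤ (+ i - 1ℤ)) * (+ c / 1)
quotient-formula r zero    T c eq =
  -- The denominator `suc r ^ 1` computes to `suc (r *ℕ 1)`, hence this choice of `d`.
  fraction-product T 1 (r *ℕ 1) c (trans (cong (λ m → T *ℕ suc m) (ℕ.*-identityʳ r)) eq)
quotient-formula r (suc j) T c eq = fraction-product T N^j 0 c (trans (ℕ.*-identityʳ T)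
  (ℕ.*-cancelʳ-≡ T (N^j *ℕ c) (suc r)
    (trans eq (trans (ℕ.*-assoc (suc r) N^j c) (ℕ.*-comm (suc r) (N^j *ℕ c))))))
  where N^j = suc r ^ j

theorem5p9 : (r i : ℕ) → i ≤ r →
    ∃[ T ] (HasCardinality (𝒰 r i) T ×
    + T / 1 ≡ (suc r ^ℤ (+ i - 1ℤ)) * (+ ((2 *ℕ r ∸ i) C r) / 1))
theorem5p9 r i i≤r =
  #parking ,
  𝒰-cardinality i+a≡r parkingConfig parkingConfig-injective parkingConfig-sound parkingConfig-complete ,
  quotient-formula r i #parking ((2 *ℕ r ∸ i) C r)
    (trans #parking-formula (cong (λ m → suc r ^ i *ℕ (m C r)) a+r≡2r∸i))
  where
  a = r ∸ i
  i+a≡r : i + a ≡ r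
  i+a≡r = ℕ.m+[n∸m]≡n i≤r
  open ParkingConfigs {r} {i} {a} i+a≡r
  a+r≡2r∸i : a + r ≡ 2 *ℕ r ∸ i
  a+r≡2r∸i = trans (ℕ.+-comm a r) (trans (sym (ℕ.+-∸-assoc r i≤r))
    (cong (λ m → r + m ∸ i) (sym (ℕ.+-identityʳ r))))
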